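{- For every pair of positive integers $k,\ell$ with $k\geq 3$, there exists a positive integer $N=N(k,\ell)$ such that for every integer $n\geq N$, $$rx_{k,\ell}(K_{n,n})=\begin{cases}3 & \text{if } k=3 \text{ and } \ell\in\{1,2\},\\ 4 & \text{if } k=3 \text{ and } \ell\geq 3,\\ k+1 & \text{if } k\geq 4.\end{cases}$$
   Context: All graphs are undirected, finite and simple. $K_{n,n}$ is the complete bipartite graph with both vertex classes of size $n$. An edge-coloring of a graph $G$ with $t$ colors is any map $c:E(G)\to\{1,\dots,t\}$ (adjacent edges may receive the same color). A tree $T$ that is a subgraph of $G$ is a rainbow tree if no two edges of $T$ have the same color. For $S\subseteq V(G)$, an $S$-tree is a tree in $G$ containing all vertices of $S$, and a rainbow $S$-tree is an $S$-tree that is a rainbow tree. Rainbow $S$-trees $T_1,\dots,T_\ell$ are internally disjoint if $E(T_i)\cap E(T_j)=\emptyset$ and $V(T_i)\cap V(T_j)=S$ for all $1\le i,j\le \ell$ with $i\neq j$. The $(k,\ell)$-rainbow index $rx_{k,\ell}(G)$ is the minimum number of colors needed in an edge-coloring of $G$ such that for every set $S$ of $k$ vertices of $G$ there exist $\ell$ internally disjoint rainbow $S$-trees. -}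

module Defs where

open import Level using (0ℓ; suc)
open import Data.Bool using (Bool; true; false)
import Data.Bool.Properties as Bool
open import Data.Fin using (Fin; splitAt)
open import Data.Fin.Subset using (Subset; _∈_; _⊆_; _∩_; ∣_∣; Nonempty)
open import Data.List using (List; _∷_; []; _++_; length)
open import Data.List.Relation.Unary.Linked using (Linked)
open import Data.List.Relation.Unary.Unique.Propositional using (Unique)
open import Data.Nat using (ℕ; _+_; _≤_)
open import Data.Product using (_×_; ∃-syntax)
open import Data.Sum using (_⊎_; [_,_]′)
open import Function using (_∘_; const)
open import Relation.Binary using (Rel; Decidable; Symmetric; Irreflexive; _⇒_)
open import Relation.Binary.Construct.Closure.ReflexiveTransitive using (Star)
open import Relation.Binary.PropositionalEquality using (_≡_; _≢_; refl; sym)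
open import Relation.Nullary using (¬_; ¬?)

record Graph : Set (suc 0ℓ) where
  field
    order    : ℕ
    _~_      : Rel (Fin order) 0ℓ
    _~?_     : Decidable _~_
    ~-sym    : Symmetric _~_
    ~-irrefl : Irreflexive _≡_ _~_

  Vertex : Set
  Vertex = Fin order

module _ (m n : ℕ) where

  side : Fin (m + n) → Bool
  side = [ const false , const true ]′ ∘ splitAt m

  completeBipartite : Graph
  completeBipartite = record
    { order    = m + n
    ; _~_      = λ u v → side u ≢ side v
    ; _~?_     = λ u v → ¬? (side u Bool.≟ side v)
    ; ~-sym    = λ u≁v eq → u≁v (sym eq)
    ; ~-irrefl = λ { refl u~u → u~u refl }
    }

module _ (G : Graph) where
  open Graph G

  -- A map E(G) → Fin t.  An undirected edge is represented by adjacency proofs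
  -- in both orientations; `color-sym` makes the color depend only on the
  -- unordered pair of ends (in particular not on the choice of proof).
  record EdgeColoring (t : ℕ) : Set where
    field
      color     : ∀ {u v} → u ~ v → Fin t
      color-sym : ∀ {u v} (p : u ~ v) (q : v ~ u) → color p ≡ color q

  record Subgraph : Set (suc 0ℓ) where
    field
      vertices : Subset order
      Edge     : Rel Vertex 0ℓ
      Edge?    : Decidable Edge
      Edge-sym : Symmetric Edge
      Edge⇒~   : Edge ⇒ _~_
      -- By symmetry, both ends of an edge lie in `vertices`.
      Edge-end : ∀ {u v} → Edge u v → u ∈ vertices

module _ {G : Graph} where
  open Graph G
  open Subgraph

  Connected : Subgraph G → Set
  Connected H = ∀ {u v} → u ∈ vertices H → v ∈ vertices H → Star (Edge H) u v

  -- The cycle x, x₁, …, xᵣ, x with r ≥ 2 and x, x₁, …, xᵣ distinct.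
  IsCycle : Subgraph G → Vertex → List Vertex → Set
  IsCycle H x xs =
    2 ≤ length xs × Unique (x ∷ xs) × Linked (Edge H) (x ∷ xs ++ x ∷ [])

  Acyclic : Subgraph G → Set
  Acyclic H = ∀ x xs → ¬ IsCycle H x xs

  IsTree : Subgraph G → Set
  IsTree H = Nonempty (vertices H) × Connected H × Acyclic H

  IsRainbow : ∀ {t} → EdgeColoring G t → Subgraph G → Set
  IsRainbow c H =
    ∀ {u v x y} (p : Edge H u v) (q : Edge H x y) →
    color (Edge⇒~ H p) ≡ color (Edge⇒~ H q) →
    (u ≡ x × v ≡ y) ⊎ (u ≡ y × v ≡ x)
    where open EdgeColoring c

  IsRainbowSTree : ∀ {t} → EdgeColoring G t → Subset order → Subgraph G → Set
  IsRainbowSTree c S T = IsTree T × S ⊆ vertices T × IsRainbow c T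

  InternallyDisjoint : ∀ {ℓ} → Subset order → (Fin ℓ → Subgraph G) → Set
  InternallyDisjoint S T =
    ∀ i j → i ≢ j →
    (∀ u v → ¬ (Edge (T i) u v × Edge (T j) u v)) ×
    vertices (T i) ∩ vertices (T j) ≡ S

  IsRainbowColoring : ∀ {t} → ℕ → ℕ → EdgeColoring G t → Set (suc 0ℓ)
  IsRainbowColoring k ℓ c =
    ∀ (S : Subset order) → ∣ S ∣ ≡ k →
    ∃[ T ] (∀ (i : Fin ℓ) → IsRainbowSTree c S (T i)) × InternallyDisjoint S T

module _ (k ℓ : ℕ) (G : Graph) where

  RainbowColorable : ℕ → Set (suc 0ℓ)
  RainbowColorable t = ∃[ c ] IsRainbowColoring {G} {t} k ℓ c

  -- rx_{k,ℓ}(G) = t, as a relation: t is the least number of colors that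
  -- suffices.
  RainbowIndex : ℕ → Set (suc 0ℓ)
  RainbowIndex t = RainbowColorable t × (∀ t′ → RainbowColorable t′ → t ≤ t′)

{-# OPTIONS --safe #-}
-- Lower bound: by pigeonhole there are two left vertices a₁, a₂ and k ∸ 2 right vertices ys all of
-- whose mutual edges have one color. Let S consist of these k vertices. A rainbow tree with at most
-- k colors has at most k + 1 vertices, and a₁, a₂ cannot both have their neighbours in ys, so a
-- rainbow S-tree has exactly one further vertex, on the right. Hence every y in ys is joined to a₁
-- or a₂ in the tree. For k ≥ 4 this gives two edges of the same color, and for k = 3 the edges y a₁
-- and y a₂ allow at most two edge-disjoint trees.
--
-- Upper bound: for large n there is a coloring in which every prescription of colors on a bounded
-- number of vertices of one side is realized by many vertices of the other side. With k + 1 colors,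
-- this gives as many rainbow double stars with leaf set S as needed. For k = 3 three colors suffice
-- for two trees: a star if S lies on one side, and otherwise two paths, each using another one of
-- the two edges inside S.
--
-- Such a coloring is built explicitly. On one side a vertex w can color all vertices x of the other
-- side by a hash function h_w(x) from a universal family, whose size is polylogarithmic in n; the
-- only conflict is between the two ends of an edge, and a small auxiliary relation on both sides
-- decides whose hash function prevails.
module Submission where

open import Data.Bool using (Bool; false; if_then_else_; not; true)
open import Data.Bool.Properties using (not-¬; ¬-not)
import Data.Bool.Properties as Bool
open import Data.Fin
  using (Fin; _↑ʳ_; _↑ˡ_; combine; finToFun; fromℕ; fromℕ<; funToFin; inject₁; inject≤; remQuot;
    splitAt; suc; toℕ; zero)
import Data.Fin as Fin
open import Data.Fin.Patterns using (0F; 1F; 2F)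
open import Data.Fin.Permutation.Components using (transpose; transpose-inverse)
open import Data.Fin.Properties
  using (<⇒notInjective; <⇒≢; _≟_; combine-injective; finToFun-funToFin; fromℕ≢inject₁;
    funToFin-finToFin; injective⇒≤; inject₁-injective; inject≤-injective; pigeonhole;
    remQuot-combine; splitAt-↑ʳ; splitAt-↑ˡ; splitAt⁻¹-↑ʳ; splitAt⁻¹-↑ˡ; suc-injective;
    toℕ-fromℕ<; toℕ-injective; toℕ-inject≤; toℕ<n; ¬∀⟶∃¬; ↑ʳ-injective; ↑ˡ-injective)
  renaming (any? to anyFin?)
open import Data.Fin.Subset
  using (Subset; _∪_; inside; outside; ⁅_⁆; ∣_∣; ⊥)
  renaming (_∈_ to _∈ˢ_; _∉_ to _∉ˢ_; _⊆_ to _⊆ˢ_)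
open import Data.Fin.Subset.Properties
  using (x∈p∩q⁺; x∈p∩q⁻; x∈p∪q⁺; x∈p∪q⁻; x∈⁅x⁆; x∈⁅y⁆⇒x≡y; ∉⊥; ∣⊥∣≡0; ⊆-antisym)
  renaming (_∈?_ to _∈ˢ?_)
open import Data.List using (List; []; _++_; _∷_; filter; length; lookup; map; take)
import Data.List.Membership.DecPropositional as DecMembership
open import Data.List.Membership.Propositional using (_∈_; _∉_; find; lose)
open import Data.List.Membership.Propositional.Properties using (∈-allFin; ∈-lookup; ∈-map⁺; ∈-map⁻)
open import Data.List.Membership.Setoid.Properties using (index-injective)
open import Data.List.Properties using (length-map; length-tabulate; length-take)
open import Data.List.Relation.Unary.All as All using (All; []; _∷_)
import Data.List.Relation.Unary.All.Properties as All
open import Data.List.Relation.Unary.AllPairs using ([]; _∷_)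
open import Data.List.Relation.Unary.Any using (any?; here; index; there)
open import Data.List.Relation.Unary.Linked using (Linked; _∷_)
open import Data.List.Relation.Unary.Unique.Propositional using (Unique)
import Data.List.Relation.Unary.Unique.Propositional.Properties as Unique
open import Data.Nat using (_*_; _+_; _<_; _^_; _≤_; suc; s≤s; zero; z≤n; ℕ)
import Data.Nat as ℕ
open import Data.Nat.DivMod using (/-monoˡ-≤; _%_; _/_; m%n<n; m*n/n≡m; m/n*n≤m; m≡m%n+[m/n]*n)
import Data.Nat.Properties as ℕ
open import Data.Nat.Tactic.RingSolver using (solve-∀)
open import Data.Product using (_,_; _×_; map₂; proj₁; proj₂; Σ-syntax; ∃-syntax)
open import Data.Sum using ([_,_]′; _⊎_; inj₁; inj₂; swap)
import Data.Vec as Vec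
open import Data.Vec.Functional as Vector using ()
open import Function using (Injective; StrictlySurjective; _∘_; const; flip; id)
open import Relation.Binary.Construct.Closure.ReflexiveTransitive
  using (Star; _◅_; _◅◅_; reverse; ε)
open import Relation.Binary.PropositionalEquality hiding (J)
open import Relation.Nullary using (Dec; contradiction; does; no; yes; ¬?; ¬_)
open import Relation.Nullary.Decidable using (_×-dec_; _⊎-dec_)
open import Relation.Unary using (Decidable)
open import Defs

-- Lists without repetition and the pigeonhole principle.

module _ {A : Set} where

  lookup-injective : ∀ {xs : List A} → Unique xs → Injective _≡_ _≡_ (lookup xs)
  lookup-injective (x∉ ∷ u) {zero}  {zero}  eq = refl
  lookup-injective (x∉ ∷ u) {zero}  {suc j} eq = contradiction eq (All.lookup x∉ (∈-lookup j))
  lookup-injective (x∉ ∷ u) {suc i} {zero}  eq = contradiction (sym eq) (All.lookup x∉ (∈-lookup i))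
  lookup-injective (x∉ ∷ u) {suc i} {suc j} eq = cong suc (lookup-injective u eq)

  Unique-⊆⇒length≤ : ∀ {xs ys : List A} → Unique xs → (∀ {x} → x ∈ xs → x ∈ ys) →
                     length xs ≤ length ys
  Unique-⊆⇒length≤ u xs⊆ys = injective⇒≤ {f = λ i → index (xs⊆ys (∈-lookup i))}
    (λ {i} {j} eq → lookup-injective u
      (index-injective (setoid A) (xs⊆ys (∈-lookup i)) (xs⊆ys (∈-lookup j)) eq))

  length-filter-∁ : ∀ {P : A → Set} (P? : Decidable P) (xs : List A) →
                    length xs ≡ length (filter P? xs) + length (filter (¬? ∘ P?) xs)
  length-filter-∁ P? [] = refl
  length-filter-∁ P? (x ∷ xs) with P? x
  ... | yes _ = cong suc (length-filter-∁ P? xs)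
  ... | no  _ = trans (cong suc (length-filter-∁ P? xs)) (sym (ℕ.+-suc _ _))

  -- Induction on the number m of values: either the fibre over the last value already has more than
  -- r elements, or discarding it costs at most r elements of the list.
  largeFibre : ∀ (f : A → ℕ) m r {xs} → Unique xs → All (λ x → f x < m) xs → m * r < length xs →
               ∃[ c ] ∃[ ys ] Unique ys × length ys ≡ suc r × All (λ y → f y ≡ c) ys
  largeFibre f zero    r u (() ∷ _) _
  largeFibre f (suc m) r {xs} u f<m len
    with suc r ℕ.≤? length (filter (λ x → f x ℕ.≟ m) xs)
  ... | yes r< = m , take (suc r) fibre , Unique.take⁺ (suc r) (Unique.filter⁺ f≟m u)
               , trans (length-take (suc r) fibre) (ℕ.m≤n⇒m⊓n≡m r<)
               , All.take⁺ (suc r) (All.all-filter f≟m xs)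
    where
    f≟m   = λ x → f x ℕ.≟ m
    fibre = filter f≟m xs
  ... | no r≮ = largeFibre f m r (Unique.filter⁺ (¬? ∘ f≟m) u) rest<m rest-len
    where
    f≟m = λ x → f x ℕ.≟ m

    rest<m : All (λ x → f x < m) (filter (¬? ∘ f≟m) xs)
    rest<m = All.zipWith (λ (fx≢m , fx<1+m) → ℕ.≤∧≢⇒< (ℕ.≤-pred fx<1+m) fx≢m)
      (All.all-filter (¬? ∘ f≟m) xs , All.filter⁺ (¬? ∘ f≟m) f<m)

    rest-len : m * r < length (filter (¬? ∘ f≟m) xs)
    rest-len = ℕ.+-cancelˡ-< r _ _ (ℕ.<-≤-trans (subst (r + m * r <_) (length-filter-∁ f≟m xs) len)
      (ℕ.+-monoˡ-≤ _ (ℕ.≤-pred (ℕ.≰⇒> r≮))))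

-- Two rows and many columns of one color.

abstract
  -- The product counts pairs among k + 1 rows together with a color; more than r times as many
  -- columns put r + 1 of them into one class. The summand k makes room for the k + 1 rows.
  lowerThreshold : ℕ → ℕ → ℕ
  lowerThreshold k r = suc (suc k * (suc k * k) * r + k)

  lowerThreshold⇒ : ∀ {k n} r → lowerThreshold k r ≤ n → k < n × suc k * (suc k * k) * r < n
  lowerThreshold⇒ {k} r N≤n =
    ℕ.≤-trans (s≤s (ℕ.m≤n+m k _)) N≤n , ℕ.≤-trans (s≤s (ℕ.m≤m+n _ k)) N≤n

MonochromaticK₂ : ∀ {n k} → ℕ → (Fin n → Fin n → Fin k) → Set
MonochromaticK₂ r f = ∃[ a₁ ] ∃[ a₂ ] ∃[ c ] ∃[ ys ] a₁ ≢ a₂ × Unique ys × length ys ≡ suc r ×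
  All (λ y → f a₁ y ≡ c × f a₂ y ≡ c) ys

-- Among k + 1 rows every column repeats a color; then pigeonhole on the repeated pair and color.
monochromaticK₂ : ∀ {k n r} → lowerThreshold k r ≤ n → (f : Fin n → Fin n → Fin k) → MonochromaticK₂ r f
monochromaticK₂ {k} {n} {r} N≤n f = decode (largeFibre (toℕ ∘ class) (suc k * (suc k * k)) r
  (Unique.allFin⁺ n) (All.universal (λ x → toℕ<n (class x)) _)
  (subst (suc k * (suc k * k) * r <_) (sym (length-tabulate {n = n} (λ i → i))) (proj₂ (lowerThreshold⇒ r N≤n))))
  where
  k<n : k < n
  k<n = proj₁ (lowerThreshold⇒ r N≤n)

  row : Fin (suc k) → Fin n
  row i = inject≤ i k<n

  repeated = λ y → pigeonhole (ℕ.n<1+n k) (λ i → f (row i) y)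
  i = proj₁ ∘ repeated
  j = λ y → proj₁ (proj₂ (repeated y))

  class : Fin n → Fin (suc k * (suc k * k))
  class y = combine (i y) (combine (j y) (f (row (i y)) y))

  -- The rows and the color found for `y₀` serve every column of its class.
  sameClass : ∀ {y y₀} → toℕ (class y) ≡ toℕ (class y₀) →
    f (row (i y₀)) y ≡ f (row (i y₀)) y₀ × f (row (j y₀)) y ≡ f (row (i y₀)) y₀
  sameClass {y} {y₀} eq with combine-injective (i y) _ (i y₀) _ (toℕ-injective eq)
  ... | i≡ , eq′ with combine-injective (j y) _ (j y₀) _ eq′
  ... | j≡ , c≡ = trans (cong (λ i → f (row i) y) (sym i≡)) c≡
                , trans (trans (cong (λ j → f (row j) y) (sym j≡)) (sym (proj₂ (proj₂ (proj₂ (repeated y)))))) c≡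

  decode : ∃[ c ] ∃[ ys ] Unique ys × length ys ≡ suc r × All (λ y → toℕ (class y) ≡ c) ys →
           MonochromaticK₂ r f
  decode (c , y₀ ∷ ys , u , length≡ , same₀ ∷ same) =
    row (i y₀) , row (j y₀) , f (row (i y₀)) y₀ , y₀ ∷ ys ,
    (λ eq → <⇒≢ (proj₁ (proj₂ (proj₂ (repeated y₀)))) (inject≤-injective k<n k<n _ _ eq)) ,
    u , length≡ , All.map (λ eq → sameClass (trans eq (sym same₀))) (same₀ ∷ same)

-- The number of vertices of a rainbow tree.

-- Supplies the edge along which the set of vertices reached so far is enlarged.
crossing : ∀ {A : Set} {E : A → A → Set} {P : A → Set} → Decidable P → ∀ {x y} → Star E x y →
           P x → ¬ P y → ∃[ u ] ∃[ v ] P u × ¬ P v × E u v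
crossing P? ε Px ¬Py = contradiction Px ¬Py
crossing P? {x} (_◅_ {j = z} e es) Px ¬Py with P? z
... | yes Pz = crossing P? es Pz ¬Py
... | no ¬Pz = x , z , Px , ¬Pz , e

module _ {G : Graph} {t} (c : EdgeColoring G t) (T : Subgraph G) where
  open Graph G
  open EdgeColoring c
  open Subgraph T
  open DecMembership (_≟_ {order}) using (_∈?_)

  -- Growing a connected vertex set one edge at a time uses a new color at each step.
  rainbow⇒order≤ : Connected T → IsRainbow c T → ∀ {xs} → Unique xs → All (_∈ˢ vertices) xs →
                   length xs ≤ suc t
  rainbow⇒order≤ conn rb {[]}      u xs∈T = z≤n
  rainbow⇒order≤ conn rb {x ∷ xs₀} u xs∈T = conclude (grow (suc t))
    where
    xs = x ∷ xs₀

    record Stage (m : ℕ) : Set where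
      field
        reached  : List Vertex
        colors   : List (Fin t)
        x-in     : x ∈ reached
        inT      : ∀ {y} → y ∈ reached → y ∈ˢ vertices
        reached# : length reached ≡ suc m
        colors#  : length colors ≡ m
        unique   : Unique colors
        spanned  : ∀ {d} → d ∈ colors →
                   ∃[ u ] ∃[ v ] ∃[ e ] u ∈ reached × v ∈ reached × color (Edge⇒~ {u} {v} e) ≡ d

    grow : ∀ m → length xs ≤ suc t ⊎ Stage m
    extend : ∀ {m} → Stage m → length xs ≤ suc t ⊎ Stage (suc m)

    grow zero = inj₂ record
      { reached = x ∷ [] ; colors = [] ; x-in = here refl
      ; inT = λ { (here refl) → All.head xs∈T ; (there ()) }
      ; reached# = refl ; colors# = refl ; unique = [] ; spanned = λ () }
    grow (suc m) with grow m
    ... | inj₁ done  = inj₁ done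
    ... | inj₂ stage = extend stage

    extend {m} stage with any? (λ y → ¬? (y ∈? Stage.reached stage)) xs
    ... | no ¬out = inj₁ (ℕ.≤-trans (Unique-⊆⇒length≤ u xs⊆)
                      (subst (_≤ suc t) (sym reached#) (s≤s (subst (_≤ t) colors# colors≤t))))
      where
      open Stage stage
      xs⊆ : ∀ {y} → y ∈ xs → y ∈ reached
      xs⊆ {y} y∈xs with y ∈? reached
      ... | yes y∈ = y∈
      ... | no  y∉ = contradiction (lose y∈xs y∉) ¬out
      colors≤t : length colors ≤ t
      colors≤t = subst (length colors ≤_) (length-tabulate {n = t} (λ i → i))
        (Unique-⊆⇒length≤ unique (λ {d} _ → ∈-allFin d))
    ... | yes out with find out
    ... | y , y∈xs , y∉ with crossing (_∈? Stage.reached stage)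
                               (conn (All.head xs∈T) (All.lookup xs∈T y∈xs)) (Stage.x-in stage) y∉
    ... | p , q , p∈ , q∉ , e = inj₂ record
      { reached = q ∷ reached ; colors = color (Edge⇒~ e) ∷ colors ; x-in = there x-in
      ; inT = λ { (here refl) → Edge-end (Edge-sym e) ; (there y∈) → inT y∈ }
      ; reached# = cong suc reached# ; colors# = cong suc colors#
      ; unique = All.tabulate fresh ∷ unique
      ; spanned = λ { (here refl) → p , q , e , there p∈ , here refl , refl
                    ; (there d∈) → let u , v , e′ , u∈ , v∈ , eq = spanned d∈
                                   in u , v , e′ , there u∈ , there v∈ , eq } }
      where
      open Stage stage
      -- A repeated color would identify `e` with an edge between reached vertices, but its end `q`
      -- is new.
      fresh : ∀ {d} → d ∈ colors → color (Edge⇒~ e) ≢ d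
      fresh d∈ eq with spanned d∈
      ... | u , v , e′ , u∈ , v∈ , eq′ with rb e e′ (trans eq (sym eq′))
      ... | inj₁ (_ , refl) = q∉ v∈
      ... | inj₂ (_ , refl) = q∉ u∈

    conclude : length xs ≤ suc t ⊎ Stage (suc t) → length xs ≤ suc t
    conclude (inj₁ done) = done
    -- This stage would have t + 1 distinct colors out of t.
    conclude (inj₂ stage) = contradiction
      (subst₂ _≤_ colors# (length-tabulate {n = t} (λ i → i))
        (Unique-⊆⇒length≤ unique (λ {d} _ → ∈-allFin d)))
      (ℕ.<⇒≱ (ℕ.n<1+n t))
      where open Stage stage

  hasNeighbour : Connected T → ∀ {x y} → x ∈ˢ vertices → y ∈ˢ vertices → x ≢ y → ∃[ z ] Edge x z
  hasNeighbour conn x∈ y∈ x≢y with conn x∈ y∈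
  ... | ε     = contradiction refl x≢y
  ... | e ◅ _ = _ , e

-- Vertex sets with prescribed elements.

insert : ∀ {n} (x : Fin n) (S : Subset n) → x ∉ˢ S →
         ∃[ S′ ] ∣ S′ ∣ ≡ suc ∣ S ∣ × (∀ {y} → y ∈ˢ S′ → y ≡ x ⊎ y ∈ˢ S) × x ∈ˢ S′ × S ⊆ˢ S′
insert zero    (inside  Vec.∷ S) x∉S = contradiction Vec.here x∉S
insert zero    (outside Vec.∷ S) x∉S = inside Vec.∷ S , refl
  , (λ { Vec.here → inj₁ refl ; (Vec.there y∈) → inj₂ (Vec.there y∈) })
  , Vec.here , λ { (Vec.there y∈) → Vec.there y∈ }
insert (suc x) (s Vec.∷ S) x∉S with insert x S (x∉S ∘ Vec.there)
... | S′ , card , ⇒ , x∈ , S⊆ = s Vec.∷ S′ , card′ s , split , Vec.there x∈ , sub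
  where
  card′ : ∀ s → ∣ s Vec.∷ S′ ∣ ≡ suc ∣ s Vec.∷ S ∣
  card′ inside  = cong suc card
  card′ outside = card
  split : ∀ {y} → y ∈ˢ s Vec.∷ S′ → y ≡ suc x ⊎ y ∈ˢ s Vec.∷ S
  split Vec.here = inj₂ Vec.here
  split (Vec.there y∈) = [ inj₁ ∘ cong suc , inj₂ ∘ Vec.there ]′ (⇒ y∈)
  sub : s Vec.∷ S ⊆ˢ s Vec.∷ S′
  sub Vec.here = Vec.here
  sub (Vec.there y∈) = Vec.there (S⊆ y∈)

fromList : ∀ {n} {xs : List (Fin n)} → Unique xs →
           ∃[ S ] ∣ S ∣ ≡ length xs × (∀ {y} → y ∈ˢ S → y ∈ xs) × All (_∈ˢ S) xs
fromList {n} {[]} [] = ⊥ , ∣⊥∣≡0 n , (λ y∈ → contradiction y∈ ∉⊥) , []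
fromList {n} {x ∷ xs} (x∉ ∷ u) with fromList u
... | S , card , S⇒ , ⇒S with insert x S (λ x∈S → All.lookup x∉ (S⇒ x∈S) refl)
... | S′ , card′ , S′⇒ , x∈ , S⊆ = S′ , trans card′ (cong suc card)
  , [ here , there ∘ S⇒ ]′ ∘ S′⇒ , x∈ ∷ All.map S⊆ ⇒S

-- The two sides of the complete bipartite graph.

module Bipartite (n : ℕ) where
  G = completeBipartite n n
  open Graph G

  left right : Fin n → Vertex
  left  = _↑ˡ n
  right = n ↑ʳ_

  side-left : ∀ a → side n n (left a) ≡ false
  side-left a = cong [ const false , const true ]′ (splitAt-↑ˡ n a n)

  side-right : ∀ b → side n n (right b) ≡ true
  side-right b = cong [ const false , const true ]′ (splitAt-↑ʳ n n b)

  left~right : ∀ a b → left a ~ right b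
  left~right a b eq with trans (sym (side-left a)) (trans eq (side-right b))
  ... | ()

  left≢right : ∀ {a b} → left a ≢ right b
  left≢right {a} {b} eq = left~right a b (cong (side n n) eq)

module _ {G : Graph} {t} (c : EdgeColoring G t) where
  open Graph G
  open EdgeColoring c

  -- `color-sym` compares opposite orientations only, so the comparison passes through the reversed
  -- edge.
  color-irrelevant : ∀ {u v} (p q : u ~ v) → color p ≡ color q
  color-irrelevant p q = trans (color-sym p (~-sym p)) (color-sym (~-sym p) q)

-- The lower bounds.

-- Here k = 3 + r. In the instance built below, S consists of `a₁`, `a₂` and the r + 1 right
-- vertices `ys`, whose edges to `a₁` and `a₂` all have one color; the last three fields are what
-- this imposes on a rainbow S-tree.
record LowerWitness {n t} (c : EdgeColoring (completeBipartite n n) t) (r : ℕ) : Set₁ where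
  open Bipartite n
  field
    S        : Subset (n + n)
    card     : ∣ S ∣ ≡ 3 + r
    a₁ a₂    : Fin n
    ys       : List (Fin n)
    length≡  : length ys ≡ suc r
    unique   : Unique ys
    enough   : ∀ {T} → IsRainbowSTree c S T → 3 + r ≤ t
    forced   : t ≤ 3 + r → ∀ {T} → IsRainbowSTree c S T → ∀ {y} → y ∈ ys →
               Subgraph.Edge T (right y) (left a₁) ⊎ Subgraph.Edge T (right y) (left a₂)
    sameEdge : ∀ {T} → IsRainbowSTree c S T → ∀ {y y′ z z′} → y ∈ ys → y′ ∈ ys →
               z ≡ left a₁ ⊎ z ≡ left a₂ → z′ ≡ left a₁ ⊎ z′ ≡ left a₂ →
               Subgraph.Edge T (right y) z → Subgraph.Edge T (right y′) z′ → y ≡ y′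

module Lower {n t} (c : EdgeColoring (completeBipartite n n) t) {a₁ a₂ γ ys} (a₁≢a₂ : a₁ ≢ a₂)
  (unique : Unique ys) {r} (length≡ : length ys ≡ suc r)
  (mono : All (λ y → EdgeColoring.color c (Bipartite.left~right n a₁ y) ≡ γ ×
                     EdgeColoring.color c (Bipartite.left~right n a₂ y) ≡ γ) ys) where
  open Bipartite n
  open EdgeColoring c
  open Graph G
  open DecMembership (_≟_ {n + n}) using (_∈?_)

  terminals : List Vertex
  terminals = left a₁ ∷ left a₂ ∷ map right ys

  left∉right : ∀ {a} → left a ∉ map right ys
  left∉right a∈ with ∈-map⁻ right a∈
  ... | _ , _ , eq = left≢right eq

  terminals-unique : Unique terminals
  terminals-unique =
    ((a₁≢a₂ ∘ ↑ˡ-injective n _ _) ∷ All.¬Any⇒All¬ _ left∉right) ∷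
    All.¬Any⇒All¬ _ left∉right ∷ Unique.map⁺ (↑ʳ-injective n _ _) unique

  length-terminals : length terminals ≡ 3 + r
  length-terminals = cong (2 +_) (trans (length-map right ys) length≡)

  mono-edge : ∀ {y z} → y ∈ ys → z ≡ left a₁ ⊎ z ≡ left a₂ → (e : right y ~ z) → color e ≡ γ
  mono-edge y∈ (inj₁ refl) e = trans (color-sym e (left~right _ _)) (proj₁ (All.lookup mono y∈))
  mono-edge y∈ (inj₂ refl) e = trans (color-sym e (left~right _ _)) (proj₂ (All.lookup mono y∈))

  module _ {T : Subgraph G} (conn : Connected T) (rb : IsRainbow c T)
           (S⊆T : All (_∈ˢ Subgraph.vertices T) terminals) where
    open Subgraph T

    extra : Set
    extra = ∃[ w ] w ∈ˢ vertices × w ∉ terminals × side n n w ≡ true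

    outsideNeighbour : ∀ {a z} → Edge (left a) z → z ∉ map right ys → extra
    outsideNeighbour {a} {z} e z∉ = z , Edge-end (Edge-sym e) , notTerminal
      , ¬-not (λ eq → Edge⇒~ e (trans (side-left a) (sym eq)))
      where
      notLeft : ∀ b → z ≢ left b
      notLeft b refl = Edge⇒~ e (trans (side-left a) (sym (side-left b)))
      notTerminal : z ∉ terminals
      notTerminal (here eq)          = notLeft a₁ eq
      notTerminal (there (here eq))  = notLeft a₂ eq
      notTerminal (there (there z∈)) = z∉ z∈

    -- If a₁ and a₂ both had a neighbour in ys, T would contain two edges of color γ.
    extraVertex : extra
    extraVertex
      with hasNeighbour c T conn (All.lookup S⊆T (here refl)) (All.lookup S⊆T (there (here refl)))
             (a₁≢a₂ ∘ ↑ˡ-injective n _ _)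
         | hasNeighbour c T conn (All.lookup S⊆T (there (here refl))) (All.lookup S⊆T (here refl))
             (a₁≢a₂ ∘ sym ∘ ↑ˡ-injective n _ _)
    ... | z₁ , e₁ | z₂ , e₂ with z₁ ∈? map right ys | z₂ ∈? map right ys
    ... | no z₁∉  | _       = outsideNeighbour e₁ z₁∉
    ... | yes _   | no z₂∉  = outsideNeighbour e₂ z₂∉
    ... | yes z₁∈ | yes z₂∈ with ∈-map⁻ right z₁∈ | ∈-map⁻ right z₂∈
    ... | y₁ , y₁∈ , refl | y₂ , y₂∈ , refl
      with rb (Edge-sym e₁) (Edge-sym e₂)
             (trans (mono-edge y₁∈ (inj₁ refl) _) (sym (mono-edge y₂∈ (inj₂ refl) _)))
    ... | inj₁ (_ , eq) = contradiction (↑ˡ-injective n _ _ eq) a₁≢a₂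
    ... | inj₂ (eq , _) = contradiction (sym eq) left≢right

    -- The terminals and the extra vertex are 4 + r vertices of T, and a rainbow tree in t colors
    -- has at most t + 1.
    colors≥ : 3 + r ≤ t
    colors≥ = let w , w∈ , w∉ , _ = extraVertex in
      ℕ.≤-pred (subst (λ m → suc m ≤ suc t) length-terminals
        (rainbow⇒order≤ c T conn rb (All.¬Any⇒All¬ _ w∉ ∷ terminals-unique) (w∈ ∷ S⊆T)))

    -- Any other neighbour of y would be a left vertex outside S. Together with the extra vertex on
    -- the right, T would then have 5 + r vertices, more than t + 1.
    usesMonoEdge : t ≤ 3 + r → ∀ {y} → y ∈ ys → Edge (right y) (left a₁) ⊎ Edge (right y) (left a₂)
    usesMonoEdge t≤ {y} y∈
      with hasNeighbour c T conn (All.lookup S⊆T (there (there (∈-map⁺ right y∈))))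
             (All.lookup S⊆T (here refl)) (left≢right ∘ sym)
    ... | z , e with z ≟ left a₁ | z ≟ left a₂
    ... | yes refl | _        = inj₁ e
    ... | no _     | yes refl = inj₂ e
    ... | no z≢a₁  | no z≢a₂  = contradiction (ℕ.≤-trans tooLong (s≤s t≤)) (ℕ.<⇒≱ (ℕ.n<1+n _))
      where
      w = proj₁ extraVertex
      w∈ = proj₁ (proj₂ extraVertex)
      w∉ = proj₁ (proj₂ (proj₂ extraVertex))
      side-w = proj₂ (proj₂ (proj₂ extraVertex))
      z≢w : z ≢ w
      z≢w refl = Edge⇒~ e (trans (side-right y) (sym side-w))
      z∉right : z ∉ map right ys
      z∉right z∈ with ∈-map⁻ right z∈
      ... | _ , _ , refl = Edge⇒~ e (trans (side-right y) (sym (side-right _)))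
      z∉ : All (z ≢_) (w ∷ terminals)
      z∉ = z≢w ∷ z≢a₁ ∷ z≢a₂ ∷ All.¬Any⇒All¬ _ z∉right
      tooLong : 5 + r ≤ suc t
      tooLong = subst (λ m → suc (suc m) ≤ suc t) length-terminals
        (rainbow⇒order≤ c T conn rb (z∉ ∷ All.¬Any⇒All¬ _ w∉ ∷ terminals-unique)
          (Edge-end (Edge-sym e) ∷ w∈ ∷ S⊆T))

  private
    S = proj₁ (fromList terminals-unique)
    terminals∈S : All (_∈ˢ S) terminals
    terminals∈S = proj₂ (proj₂ (proj₂ (fromList terminals-unique)))

  witness : LowerWitness c r
  witness = record
    { S = S ; card = trans (proj₁ (proj₂ (fromList terminals-unique))) length-terminals
    ; a₁ = a₁ ; a₂ = a₂ ; ys = ys ; length≡ = length≡ ; unique = unique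
    ; enough = λ {T} → enough {T} ; forced = λ t≤ {T} → forced t≤ {T} ; sameEdge = λ {T} → sameEdge {T} }
    where
    enough : ∀ {T} → IsRainbowSTree c S T → 3 + r ≤ t
    enough {T} ((_ , conn , _) , S⊆T , rb) = colors≥ {T} conn rb (All.map S⊆T terminals∈S)

    forced : t ≤ 3 + r → ∀ {T} → IsRainbowSTree c S T → ∀ {y} → y ∈ ys →
             Subgraph.Edge T (right y) (left a₁) ⊎ Subgraph.Edge T (right y) (left a₂)
    forced t≤ {T} ((_ , conn , _) , S⊆T , rb) = usesMonoEdge {T} conn rb (All.map S⊆T terminals∈S) t≤

    right≢left : ∀ {y z} → z ≡ left a₁ ⊎ z ≡ left a₂ → right y ≢ z
    right≢left (inj₁ refl) eq = left≢right (sym eq)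
    right≢left (inj₂ refl) eq = left≢right (sym eq)

    sameEdge : ∀ {T} → IsRainbowSTree c S T → ∀ {y y′ z z′} → y ∈ ys → y′ ∈ ys →
               z ≡ left a₁ ⊎ z ≡ left a₂ → z′ ≡ left a₁ ⊎ z′ ≡ left a₂ →
               Subgraph.Edge T (right y) z → Subgraph.Edge T (right y′) z′ → y ≡ y′
    sameEdge (_ , _ , rb) {y} y∈ y′∈ z≡ z′≡ e e′
      with rb e e′ (trans (mono-edge y∈ z≡ _) (sym (mono-edge y′∈ z′≡ _)))
    ... | inj₁ (eq , _) = ↑ʳ-injective n _ _ eq
    ... | inj₂ (eq , _) = contradiction eq (right≢left {y} z′≡)

lowerWitness : ∀ {n t r} (c : EdgeColoring (completeBipartite n n) t) → t ≤ 3 + r →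
               lowerThreshold (3 + r) r ≤ n → LowerWitness c r
lowerWitness {n} {t} {r} c t≤k N≤n = build
  (monochromaticK₂ N≤n (λ a b → inject≤ (EdgeColoring.color c (Bipartite.left~right n a b)) t≤k))
  where
  open Bipartite n
  open EdgeColoring c
  build : MonochromaticK₂ r (λ a b → inject≤ (color (left~right a b)) t≤k) → LowerWitness c r
  build (a₁ , a₂ , γ , y₀ ∷ ys , a₁≢a₂ , unique , length≡ , mono₀ ∷ mono) =
    Lower.witness c {a₁} {a₂} a₁≢a₂ unique length≡ (All.map lower-color (mono₀ ∷ mono))
    where
    -- The color γ lives in `Fin (3 + r)`. The color at `y₀` serves as the common color in `Fin t`,
    -- and injectivity of the embedding transfers the equalities.
    lower-color : ∀ {y} →
      inject≤ (color (left~right a₁ y)) t≤k ≡ γ × inject≤ (color (left~right a₂ y)) t≤k ≡ γ →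
      color (left~right a₁ y) ≡ color (left~right a₁ y₀) × color (left~right a₂ y) ≡ color (left~right a₁ y₀)
    lower-color (eq₁ , eq₂) =
        inject≤-injective t≤k t≤k _ _ (trans eq₁ (sym (proj₁ mono₀)))
      , inject≤-injective t≤k t≤k _ _ (trans eq₂ (sym (proj₁ mono₀)))

module _ {n ℓ t r : ℕ} (N≤n : lowerThreshold (3 + r) r ≤ n) where
  open Bipartite n

  -- Only t ≤ 3 + r needs an argument, and there a single rainbow S-tree suffices.
  colorable⇒k≤ : 1 ≤ ℓ → RainbowColorable (3 + r) ℓ G t → 3 + r ≤ t
  colorable⇒k≤ (s≤s _) (c , rainbow) = [ few , ℕ.<⇒≤ ]′ (ℕ.≤-<-connex t (3 + r))
    where
    few : t ≤ 3 + r → 3 + r ≤ t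
    few t≤ = enough {proj₁ spanned zero} (proj₁ (proj₂ spanned) zero)
      where
      open LowerWitness (lowerWitness c t≤ N≤n)
      spanned = rainbow S card

  -- If t ≤ 3 + r, each tree joins every y in `ys` to `a₁` or `a₂` by an edge of the common color.
  -- For r ≥ 1 two such edges clash within one tree; for ℓ ≥ 3 two of three trees share such an edge
  -- at a fixed y.
  colorable⇒k< : 1 ≤ r ⊎ 3 ≤ ℓ → 1 ≤ ℓ → RainbowColorable (3 + r) ℓ G t → 4 + r ≤ t
  colorable⇒k< r≥1⊎ℓ≥3 1≤ℓ (c , rainbow) = [ few , id ]′ (ℕ.≤-<-connex t (3 + r))
    where
    few : t ≤ 3 + r → 4 + r ≤ t
    few t≤ = contradiction r≥1⊎ℓ≥3 [ manyTerminals , manyTrees ]′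
      where
      open LowerWitness (lowerWitness c t≤ N≤n)
      T : Fin ℓ → Subgraph G
      T = proj₁ (rainbow S card)
      trees : ∀ i → IsRainbowSTree c S (T i)
      trees = proj₁ (proj₂ (rainbow S card))
      disjoint : InternallyDisjoint S T
      disjoint = proj₂ (proj₂ (rainbow S card))

      twoEdges : ∀ i {y y′} → y ∈ ys → y′ ∈ ys → y ≡ y′
      twoEdges i y∈ y′∈ = compare (forced t≤ {T i} (trees i) y∈) (forced t≤ {T i} (trees i) y′∈)
        where
        open Subgraph (T i) using (Edge)
        compare : Edge (right _) (left a₁) ⊎ Edge (right _) (left a₂) →
                  Edge (right _) (left a₁) ⊎ Edge (right _) (left a₂) → _
        compare (inj₁ e) (inj₁ e′) = sameEdge {T i} (trees i) y∈ y′∈ (inj₁ refl) (inj₁ refl) e e′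
        compare (inj₁ e) (inj₂ e′) = sameEdge {T i} (trees i) y∈ y′∈ (inj₁ refl) (inj₂ refl) e e′
        compare (inj₂ e) (inj₁ e′) = sameEdge {T i} (trees i) y∈ y′∈ (inj₂ refl) (inj₁ refl) e e′
        compare (inj₂ e) (inj₂ e′) = sameEdge {T i} (trees i) y∈ y′∈ (inj₂ refl) (inj₂ refl) e e′

      manyTerminals : ¬ (1 ≤ r)
      manyTerminals 1≤r = go ys unique length≡ twoEdges 1≤r 1≤ℓ
        where
        go : ∀ {r ℓ} ys → Unique ys → length ys ≡ suc r →
             (Fin ℓ → ∀ {y y′} → y ∈ ys → y′ ∈ ys → y ≡ y′) → 1 ≤ r → ¬ (1 ≤ ℓ)
        go (y ∷ [])     _ refl _ () _
        go (y ∷ y′ ∷ _) ((y≢y′ ∷ _) ∷ _) _ all≡ _ (s≤s _) = y≢y′ (all≡ zero (here refl) (there (here refl)))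

      manyTrees : ¬ (3 ≤ ℓ)
      manyTrees 3≤ℓ = contradiction (pigeonhole (ℕ.≤-refl {3}) (λ i → which (inject≤ i 3≤ℓ))) clash
        where
        y : ∃[ y ] y ∈ ys
        y = go ys length≡
          where
          go : ∀ {r} ys → length ys ≡ suc r → ∃[ y ] y ∈ ys
          go (y ∷ _) _ = y , here refl
        centre : Fin 2 → Fin n
        centre zero       = a₁
        centre (suc zero) = a₂
        choice : ∀ i → ∃[ j ] Subgraph.Edge (T i) (right (proj₁ y)) (left (centre j))
        choice i = [ zero ,_ , suc zero ,_ ]′ (forced t≤ {T i} (trees i) (proj₂ y))
        which = proj₁ ∘ choice
        clash : ¬ (∃[ i ] ∃[ j ] i Fin.< j × which (inject≤ i 3≤ℓ) ≡ which (inject≤ j 3≤ℓ))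
        clash (i , j , i<j , eq) = proj₁ (disjoint (inject≤ i 3≤ℓ) (inject≤ j 3≤ℓ)
          (<⇒≢ i<j ∘ inject≤-injective 3≤ℓ 3≤ℓ i j)) _ _
          ( proj₂ (choice (inject≤ i 3≤ℓ))
          , subst (λ k → Subgraph.Edge (T (inject≤ j 3≤ℓ)) (right (proj₁ y)) (left (centre k))) (sym eq)
              (proj₂ (choice (inject≤ j 3≤ℓ))))

-- Finite enumerations and a universal hash family.

-- If every value were attained, choosing preimages would inject `Fin (suc m)` into `Fin m`.
missedValue : ∀ {m} (f : Fin m → Fin (suc m)) → ∃[ c ] (∀ x → f x ≢ c)
missedValue {m} f =
  let c , c∉ = ¬∀⟶∃¬ (suc m) (λ c → ∃[ x ] f x ≡ c) (λ c → anyFin? (λ x → f x ≟ c)) notSurjective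
  in c , λ x eq → c∉ (x , eq)
  where
  notSurjective : ¬ (∀ c → ∃[ x ] f x ≡ c)
  notSurjective f⁻¹ = <⇒notInjective {f = proj₁ ∘ f⁻¹} (ℕ.n<1+n m) λ {i} {j} eq →
    trans (sym (proj₂ (f⁻¹ i))) (trans (cong f eq) (proj₂ (f⁻¹ j)))

-- Repetitions are allowed, so that an enumeration can be stretched to any larger n, as `enum-≤`
-- does.
Enumeration : ℕ → Set → Set
Enumeration n A = Σ[ f ∈ (Fin n → A) ] StrictlySurjective _≡_ f

enumFin : ∀ n → Enumeration n (Fin n)
enumFin n = id , λ i → i , refl

enum-× : ∀ {m n A B} → Enumeration m A → Enumeration n B → Enumeration (m * n) (A × B)
enum-× {m} {n} (f , f⁻¹) (g , g⁻¹) = (λ i → let j , l = remQuot {m} n i in f j , g l) , λ (a , b) →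
  let j , fj≡a = f⁻¹ a
      l , gl≡b = g⁻¹ b
  in combine j l , cong₂ _,_
       (trans (cong (f ∘ proj₁) (remQuot-combine j l)) fj≡a)
       (trans (cong (g ∘ proj₂) (remQuot-combine {m} j l)) gl≡b)

enum-≤ : ∀ {m n A} → A → m ≤ n → Enumeration m A → Enumeration n A
enum-≤ {m} {n} {A} a₀ m≤n (f , f⁻¹) = g , λ a → let i , eq = f⁻¹ a in inject≤ i m≤n , trans (g-inject≤ i) eq
  where
  g : Fin n → A
  g x with toℕ x ℕ.<? m
  ... | yes x<m = f (fromℕ< x<m)
  ... | no  _   = a₀
  g-inject≤ : ∀ i → g (inject≤ i m≤n) ≡ f i
  g-inject≤ i with toℕ (inject≤ i m≤n) ℕ.<? m
  ... | yes p = cong f (toℕ-injective (trans (toℕ-fromℕ< p) (toℕ-inject≤ i m≤n)))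
  ... | no ¬p = contradiction (subst (_< m) (sym (toℕ-inject≤ i m≤n)) (toℕ<n i)) ¬p

funToFin-injective : ∀ {m n} (f g : Fin m → Fin n) → funToFin f ≡ funToFin g → ∀ i → f i ≡ g i
funToFin-injective f g eq i =
  trans (sym (finToFun-funToFin f i)) (trans (cong (λ z → finToFun z i) eq) (finToFun-funToFin g i))

funToFin-cong : ∀ {m n} {f g : Fin m → Fin n} → (∀ i → f i ≡ g i) → funToFin f ≡ funToFin g
funToFin-cong {zero}  eq = refl
funToFin-cong {suc m} eq = cong₂ combine (eq zero) (funToFin-cong (eq ∘ suc))

finToFun-injective : ∀ {m n} (x y : Fin (m ^ n)) → (∀ i → finToFun {m} {n} x i ≡ finToFun {m} {n} y i) → x ≡ y
finToFun-injective {m} {n} x y eq =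
  trans (sym (funToFin-finToFin {n} {m} x)) (trans (funToFin-cong eq) (funToFin-finToFin {n} {m} y))

-- The points of Fin n are written in binary with suc d digits. A hash function reads
-- k * k digits, one for each pair among k points to be separated, and looks the result up
-- in a table.
module Hashing (k d t : ℕ) {n} (n≤ : n ≤ 2 ^ suc d) where

  Code : Set
  Code = Fin (suc d ^ (k * k)) × Fin (suc t ^ (2 ^ (k * k)))

  digit : Fin n → Fin (suc d) → Fin 2
  digit x = finToFun {2} {suc d} (inject≤ x n≤)

  key : (Fin (k * k) → Fin (suc d)) → Fin n → Fin (2 ^ (k * k))
  key positions x = funToFin (digit x ∘ positions)

  hash : Code → Fin n → Fin (suc t)
  hash (positions , table) x = finToFun {suc t} {2 ^ (k * k)} table (key (finToFun {suc d} {k * k} positions) x)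

  -- Distinct points differ in some binary digit. For equal points digit 0 is returned, which makes
  -- the choice total and lets the points below repeat.
  separatingDigit : ∀ x y → ∃[ e ] (digit x e ≡ digit y e → x ≡ y)
  separatingDigit x y with x ≟ y
  ... | yes x≡y = zero , λ _ → x≡y
  ... | no  x≢y =
    let e , e≢ = ¬∀⟶∃¬ (suc d) (λ e → digit x e ≡ digit y e) (λ e → digit x e ≟ digit y e)
                   (λ eq → x≢y (inject≤-injective n≤ n≤ _ _ (finToFun-injective {2} {suc d} _ _ eq)))
    in e , λ eq → contradiction eq e≢

  -- The digit read for the pair (i, j) separates `p i` from `p j`. So points with the same key are
  -- equal, and the table can prescribe the value of g at each key.
  hash-universal : ∀ (p : Fin k → Fin n) (g : Fin n → Fin (suc t)) → ∃[ w ] (∀ i → hash w (p i) ≡ g (p i))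
  hash-universal p g = (funToFin positions , funToFin table) , correct
    where
    positions : Fin (k * k) → Fin (suc d)
    positions s = let i , j = remQuot {k} k s in proj₁ (separatingDigit (p i) (p j))

    positions′ : Fin (k * k) → Fin (suc d)
    positions′ = finToFun {suc d} {k * k} (funToFin positions)

    match? : ∀ z → Dec (∃[ i ] key positions′ (p i) ≡ z)
    match? z = anyFin? (λ i → key positions′ (p i) ≟ z)

    table : Fin (2 ^ (k * k)) → Fin (suc t)
    table z with match? z
    ... | yes (i , _) = g (p i)
    ... | no  _       = zero

    key-injective : ∀ i j → key positions′ (p i) ≡ key positions′ (p j) → p i ≡ p j
    key-injective i j eq = proj₂ (separatingDigit (p i) (p j))
      (subst (λ e → digit (p i) e ≡ digit (p j) e) position≡ (funToFin-injective _ _ eq (combine i j)))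
      where
      position≡ : positions′ (combine i j) ≡ proj₁ (separatingDigit (p i) (p j))
      position≡ = trans (finToFun-funToFin positions (combine i j))
        (cong (λ (i , j) → proj₁ (separatingDigit (p i) (p j))) (remQuot-combine {k} i j))

    table-key : ∀ i → table (key positions′ (p i)) ≡ g (p i)
    table-key i with match? (key positions′ (p i))
    ... | yes (j , eq) = cong g (key-injective j i eq)
    ... | no  none     = contradiction (i , refl) none

    correct : ∀ i → hash (funToFin positions , funToFin table) (p i) ≡ g (p i)
    correct i = trans (finToFun-funToFin table (key positions′ (p i))) (table-key i)

-- Colorings with the extension property.

-- An analogue for edge colors of the extension property of random graphs. Tags keep the vertices
-- chosen for different trees apart, and X lists vertices to be avoided.
Extension : ∀ {n t ℓ} → ℕ → (Fin n → Fin n → Fin t) → (Fin n → Fin ℓ) → Set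
Extension {n} {t} k f tag = ∀ i (X p : Fin k → Fin n) (g : Fin n → Fin t) →
  ∃[ a ] tag a ≡ i × (∀ j → X j ≢ a) × (∀ j → f a (p j) ≡ g (p j))

record ExtensionColoring (n t k ℓ : ℕ) : Set where
  field
    color       : Fin n → Fin n → Fin t
    tagˡ tagʳ   : Fin n → Fin ℓ
    extensionˡ  : Extension k color tagˡ
    extensionʳ  : Extension k (flip color) tagʳ

module _ {n t k ℓ : ℕ} {Kind Kind′ Code : Set} {hash : Code → Fin n → Fin t}
  (universal : ∀ (p : Fin k → Fin n) (g : Fin n → Fin t) → ∃[ w ] (∀ i → hash w (p i) ≡ g (p i)))
  {attr : Fin n → Kind × Code × Fin ℓ × Fin (suc k)} (attr⁻¹ : StrictlySurjective _≡_ attr)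
  {kind′ : Fin n → Kind′} {R : Kind → Kind′ → Set}
  (dominated : ∀ (q : Fin k → Kind′) → ∃[ i ] (∀ j → R i (q j)))
  {f : Fin n → Fin n → Fin t}
  (f-hash : ∀ a b → R (proj₁ (attr a)) (kind′ b) → f a b ≡ hash (proj₁ (proj₂ (attr a))) b)
  where

  -- Every combination of attributes occurs, so each can be chosen separately: a kind that prevails
  -- over the kinds of all `p j`, a code that hashes them to g, the tag i, and one of k + 1 copies
  -- that none of the k vertices in X has.
  domination⇒extension : Extension k f (proj₁ ∘ proj₂ ∘ proj₂ ∘ attr)
  domination⇒extension i X p g
    with dominated (kind′ ∘ p) | universal p g | missedValue (proj₂ ∘ proj₂ ∘ proj₂ ∘ attr ∘ X)
  ... | kind , R-kind | w , w-correct | copy , copy∉X with attr⁻¹ (kind , w , i , copy)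
  ... | a , eq = a , cong (proj₁ ∘ proj₂ ∘ proj₂) eq
    , (λ { j refl → copy∉X j (cong (proj₂ ∘ proj₂ ∘ proj₂) eq) })
    , λ j → trans (f-hash a (p j) (subst (λ z → R (proj₁ z) (kind′ (p j))) (sym eq) (R-kind j)))
              (trans (cong (λ z → hash (proj₁ (proj₂ z)) (p j)) eq) (w-correct j))

-- The number of hash functions: polynomial in d, hence polylogarithmic in n.
codes : ℕ → ℕ → ℕ → ℕ
codes k d t = suc d ^ (k * k) * suc t ^ (2 ^ (k * k))

-- Left kinds are the points of a set of size k * k + 1, right kinds are k-tuples of such
-- points. No k tuples cover all points, while every k points are the entries of a tuple.
-- Whether the left kind occurs in the right tuple decides which end hashes the other one.
extensionColoring : ∀ k d t ℓ {n} → n ≤ 2 ^ suc d →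
  suc (k * k) * (codes k d t * (suc ℓ * suc k)) ≤ n →
  suc (k * k) ^ k * (codes k d t * (suc ℓ * suc k)) ≤ n →
  ExtensionColoring n (suc t) k (suc ℓ)
extensionColoring k d t ℓ {n} n≤ I≤n J≤n = record
  { color = color
  ; tagˡ = proj₁ ∘ proj₂ ∘ proj₂ ∘ proj₁ attrˡ
  ; tagʳ = proj₁ ∘ proj₂ ∘ proj₂ ∘ proj₁ attrʳ
  ; extensionˡ = domination⇒extension {hash = hash} hash-universal (proj₂ attrˡ) {R = λ i j → ¬ Occurs i j} uncovered color-¬occurs
  ; extensionʳ = domination⇒extension {hash = hash} hash-universal (proj₂ attrʳ) {R = flip Occurs} covering (flip color-occurs)
  }
  where
  open Hashing k d t n≤
  I J : Set
  I = Fin (suc (k * k))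
  J = Fin (suc (k * k) ^ k)

  entries : J → Fin k → I
  entries = finToFun {suc (k * k)} {k}

  Occurs : I → J → Set
  Occurs i j = ∃[ s ] entries j s ≡ i

  occurs? : ∀ i j → Dec (Occurs i j)
  occurs? i j = anyFin? (λ s → entries j s ≟ i)

  enumRest : Enumeration (codes k d t * (suc ℓ * suc k)) (Code × Fin (suc ℓ) × Fin (suc k))
  enumRest = enum-× (enum-× (enumFin _) (enumFin _)) (enum-× (enumFin _) (enumFin _))

  rest₀ : Code × Fin (suc ℓ) × Fin (suc k)
  rest₀ = (funToFin {k * k} (λ _ → zero) , funToFin {2 ^ (k * k)} (λ _ → zero)) , zero , zero

  attrˡ : Enumeration n (I × Code × Fin (suc ℓ) × Fin (suc k))
  attrˡ = enum-≤ (zero , rest₀) I≤n (enum-× (enumFin _) enumRest)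

  attrʳ : Enumeration n (J × Code × Fin (suc ℓ) × Fin (suc k))
  attrʳ = enum-≤ (funToFin {k} (λ _ → zero) , rest₀) J≤n (enum-× (enumFin _) enumRest)

  kindˡ : Fin n → I
  kindˡ = proj₁ ∘ proj₁ attrˡ
  kindʳ : Fin n → J
  kindʳ = proj₁ ∘ proj₁ attrʳ
  codeˡ codeʳ : Fin n → Code
  codeˡ = proj₁ ∘ proj₂ ∘ proj₁ attrˡ
  codeʳ = proj₁ ∘ proj₂ ∘ proj₁ attrʳ

  color : Fin n → Fin n → Fin (suc t)
  color a b = if does (occurs? (kindˡ a) (kindʳ b)) then hash (codeʳ b) a else hash (codeˡ a) b

  color-occurs : ∀ a b → Occurs (kindˡ a) (kindʳ b) → color a b ≡ hash (codeʳ b) a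
  color-occurs a b occ with occurs? (kindˡ a) (kindʳ b)
  ... | yes _  = refl
  ... | no ¬occ = contradiction occ ¬occ

  color-¬occurs : ∀ a b → ¬ Occurs (kindˡ a) (kindʳ b) → color a b ≡ hash (codeˡ a) b
  color-¬occurs a b ¬occ with occurs? (kindˡ a) (kindʳ b)
  ... | yes occ = contradiction occ ¬occ
  ... | no  _   = refl

  uncovered : ∀ (q : Fin k → J) → ∃[ i ] (∀ j → ¬ Occurs i (q j))
  uncovered q =
    -- The k tuples have k * k entries together, one fewer than there are points.
    let i , i∉ = missedValue (λ s → let j , s′ = remQuot {k} k s in entries (q j) s′)
    in i , λ j (s , eq) → i∉ (combine j s)
         (trans (cong (λ (j , s′) → entries (q j) s′) (remQuot-combine {k} j s)) eq)

  covering : ∀ (q : Fin k → I) → ∃[ j ] (∀ i → Occurs (q i) j)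
  covering q = funToFin q , λ i → i , finToFun-funToFin q i

-- Existence of extension colorings for large n.

n<2^n : ∀ n → n < 2 ^ n
n<2^n zero    = s≤s z≤n
n<2^n (suc n) = ℕ.+-mono-≤ (ℕ.m^n>0 2 n) (ℕ.≤-trans (n<2^n n) (ℕ.m≤m+n _ 0))

^-distribʳ-* : ∀ m n o → (m * n) ^ o ≡ m ^ o * n ^ o
^-distribʳ-* m n zero    = refl
^-distribʳ-* m n (suc o) = trans (cong (m * n *_) (^-distribʳ-* m n o)) (interchange m n (m ^ o) (n ^ o))
  where
  interchange : ∀ a b c d → a * b * (c * d) ≡ a * c * (b * d)
  interchange = solve-∀

-- With d = q (c + 1) + r: (d + 1)^c ≤ ((c + 1) 2^q)^c and 2^d ≥ 2^q 2^(qc).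
poly≤exp : ∀ K c → ∃[ D ] (∀ d → D ≤ d → K * suc d ^ c ≤ 2 ^ d)
-- For d from this value on, the quotient q is at least `K * s ^ c`, which `2 ^ q` absorbs.
poly≤exp K c = K * s ^ c * s , bound
  where
  s = suc c
  bound : ∀ d → K * s ^ c * s ≤ d → K * suc d ^ c ≤ 2 ^ d
  bound d D≤d = begin
    K * suc d ^ c              ≤⟨ ℕ.*-monoʳ-≤ K (ℕ.^-monoˡ-≤ c 1+d≤) ⟩
    K * (s * 2 ^ q) ^ c        ≡⟨ cong (K *_) (trans (^-distribʳ-* s (2 ^ q) c) (cong (s ^ c *_) (ℕ.^-*-assoc 2 q c))) ⟩
    K * (s ^ c * 2 ^ (q * c))  ≡⟨ ℕ.*-assoc K _ _ ⟨
    K * s ^ c * 2 ^ (q * c)    ≤⟨ ℕ.*-monoˡ-≤ (2 ^ (q * c)) (ℕ.≤-trans Ks^c≤q (ℕ.<⇒≤ (n<2^n q))) ⟩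
    2 ^ q * 2 ^ (q * c)        ≡⟨ ℕ.^-distribˡ-+-* 2 q (q * c) ⟨
    2 ^ (q + q * c)            ≡⟨ cong (2 ^_) (ℕ.*-suc q c) ⟨
    2 ^ (q * s)                ≤⟨ ℕ.^-monoʳ-≤ 2 (m/n*n≤m d s) ⟩
    2 ^ d                      ∎
    where
    open ℕ.≤-Reasoning
    q = d / s
    Ks^c≤q : K * s ^ c ≤ q
    Ks^c≤q = subst (_≤ q) (m*n/n≡m (K * s ^ c) s) (/-monoˡ-≤ s D≤d)
    1+d≤ : suc d ≤ s * 2 ^ q
    1+d≤ = begin
      suc d              ≡⟨ cong suc (m≡m%n+[m/n]*n d s) ⟩
      suc (d % s) + q * s ≤⟨ ℕ.+-monoˡ-≤ (q * s) (m%n<n d s) ⟩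
      suc q * s          ≡⟨ ℕ.*-comm (suc q) s ⟩
      s * suc q          ≤⟨ ℕ.*-monoʳ-≤ s (n<2^n q) ⟩
      s * 2 ^ q          ∎

binaryLength : ∀ n → 1 ≤ n → ∃[ d ] 2 ^ d ≤ n × n < 2 ^ suc d
binaryLength (suc zero)    _ = 0 , s≤s z≤n , s≤s (s≤s z≤n)
binaryLength (suc n@(suc _)) _ with binaryLength n (s≤s z≤n)
... | d , 2^d≤n , n< with suc n ℕ.<? 2 ^ suc d
... | yes 1+n< = d , ℕ.m≤n⇒m≤1+n 2^d≤n , 1+n<
... | no  1+n≮ = suc d , ℕ.≮⇒≥ 1+n≮ , ℕ.≤-<-trans n< (ℕ.^-monoʳ-< 2 (s≤s (s≤s z≤n)) (ℕ.n<1+n (suc d)))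

-- If n has d + 1 binary digits, the attributes on either side number a constant times
-- `suc d ^ (k * k)`. For large d this is at most `2 ^ d` and so at most n.
extensionColorings : ∀ k t ℓ → ∃[ N ] (∀ n → N ≤ n → ExtensionColoring n (suc t) k (suc ℓ))
extensionColorings k t ℓ = 2 ^ (D I ℕ.⊔ D J) , build
  where
  I = suc (k * k)
  J = suc (k * k) ^ k
  rest = suc t ^ (2 ^ (k * k)) * (suc ℓ * suc k)
  threshold = λ m → poly≤exp (m * rest) (k * k)
  D = proj₁ ∘ threshold

  build : ∀ n → 2 ^ (D I ℕ.⊔ D J) ≤ n → ExtensionColoring n (suc t) k (suc ℓ)
  build n N≤n with binaryLength n (ℕ.≤-trans (ℕ.m^n>0 2 (D I ℕ.⊔ D J)) N≤n)
  ... | d , 2^d≤n , n<2^1+d = extensionColoring k d t ℓ (ℕ.<⇒≤ n<2^1+d)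
          (fits I (ℕ.≤-trans (ℕ.m≤m⊔n (D I) (D J)) D≤d)) (fits J (ℕ.≤-trans (ℕ.m≤n⊔m (D I) (D J)) D≤d))
    where
    D≤d : D I ℕ.⊔ D J ≤ d
    D≤d = ℕ.≮⇒≥ λ d<D → ℕ.<⇒≱ n<2^1+d (ℕ.≤-trans (ℕ.^-monoʳ-≤ 2 d<D) N≤n)
    regroup : ∀ a b c e → a * (b * c * e) ≡ a * (c * e) * b
    regroup = solve-∀
    fits : ∀ m → D m ≤ d → m * (codes k d t * (suc ℓ * suc k)) ≤ n
    fits m Dm≤d = ℕ.≤-trans
      (ℕ.≤-reflexive (regroup m (suc d ^ (k * k)) (suc t ^ (2 ^ (k * k))) (suc ℓ * suc k)))
      (ℕ.≤-trans (proj₂ (threshold m) d Dm≤d) 2^d≤n)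

-- Trees given by parent maps.

-- A closed walk without backtracking first climbs and then descends, since a vertex has only
-- one parent; so it returns to x through the parent by which it left.
module _ {A : Set} {Up : A → A → Set} (depth : A → ℕ)
  (functional : ∀ {x y z} → Up x y → Up x z → y ≡ z) (rises : ∀ {x y} → Up x y → depth y < depth x) where

  private
    Adjacent : A → A → Set
    Adjacent x y = Up x y ⊎ Up y x

  -- After a step down from p to q, going up again would lead back to p, as q has only one parent.
  -- So the walk keeps descending and enters x from its parent.
  descent : ∀ {x p q} ys → Up q p → Linked Adjacent (q ∷ ys ++ x ∷ []) → Unique (p ∷ q ∷ ys) →
            All (x ≢_) (p ∷ q ∷ ys) → depth q < depth x × (∃[ l ] l ∈ q ∷ ys × Up x l)
  descent [] q↑p (inj₁ q↑x ∷ _) _ (x≢p ∷ _) = contradiction (functional q↑x q↑p) x≢p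
  descent [] q↑p (inj₂ x↑q ∷ _) _ _         = rises x↑q , _ , here refl , x↑q
  descent (z ∷ ys) q↑p (inj₁ q↑z ∷ _) ((_ ∷ p≢z ∷ _) ∷ _) _ = contradiction (functional q↑p q↑z) p≢z
  descent (z ∷ ys) q↑p (inj₂ z↑q ∷ walk) (_ ∷ u) (_ ∷ x≢)
    with descent ys z↑q walk u x≢
  ... | z<x , l , l∈ , x↑l = ℕ.<-trans (rises z↑q) z<x , l , there l∈ , x↑l

  -- Either the walk climbs all the way, and x lies above p, or it turns at some point and `descent`
  -- applies from there.
  ascent : ∀ {x p q} ys → Adjacent p q → Linked Adjacent (q ∷ ys ++ x ∷ []) → Unique (p ∷ q ∷ ys) →
           All (x ≢_) (p ∷ q ∷ ys) → depth x < depth p ⊎ (∃[ l ] l ∈ q ∷ ys × Up x l)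
  ascent ys (inj₂ q↑p) walk u x≢ = inj₂ (proj₂ (descent ys q↑p walk u x≢))
  ascent [] (inj₁ p↑q) (inj₁ q↑x ∷ _) _ _ = inj₁ (ℕ.<-trans (rises q↑x) (rises p↑q))
  ascent [] (inj₁ p↑q) (inj₂ x↑q ∷ _) _ _ = inj₂ (_ , here refl , x↑q)
  ascent (z ∷ ys) (inj₁ p↑q) (q–z ∷ walk) (_ ∷ u) (_ ∷ x≢) with ascent ys q–z walk u x≢
  ... | inj₁ x<q            = inj₁ (ℕ.<-trans x<q (rises p↑q))
  ... | inj₂ (l , l∈ , x↑l) = inj₂ (l , there l∈ , x↑l)

  noCycle : ∀ x p q ys → Linked Adjacent (x ∷ p ∷ q ∷ ys ++ x ∷ []) → ¬ Unique (x ∷ p ∷ q ∷ ys)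
  noCycle x p q ys (inj₁ x↑p ∷ p–q ∷ walk) (x≢ ∷ u@(p≢ ∷ _)) with ascent ys p–q walk u x≢
  ... | inj₁ x<p            = ℕ.<-asym x<p (rises x↑p)
  ... | inj₂ (l , l∈ , x↑l) = All.lookup p≢ l∈ (functional x↑p x↑l)
  noCycle x p q ys (inj₂ p↑x ∷ inj₁ p↑q ∷ walk) ((_ ∷ x≢q ∷ _) ∷ _) = x≢q (functional p↑x p↑q)
  noCycle x p q ys (inj₂ p↑x ∷ inj₂ q↑p ∷ walk) (x≢ ∷ u) =
    ℕ.<-asym (proj₁ (descent ys q↑p walk u x≢)) (ℕ.<-trans (rises p↑x) (rises q↑p))

module _ (G : Graph) where
  open Graph G

  -- Height two is enough for both the double stars and the anchored stars below.
  record ParentTree : Set where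
    field
      nodes    : Subset order
      root     : Vertex
      parent   : Vertex → Vertex
      root∈    : root ∈ˢ nodes
      parent∈  : ∀ {x} → x ∈ˢ nodes → x ≢ root → parent x ∈ˢ nodes
      parent~  : ∀ {x} → x ∈ˢ nodes → x ≢ root → x ~ parent x
      height≤2 : ∀ {x} → x ∈ˢ nodes → x ≢ root → parent x ≢ root → parent (parent x) ≡ root

    Up : Vertex → Vertex → Set
    Up x y = x ∈ˢ nodes × x ≢ root × y ≡ parent x

    Up? : ∀ x y → Dec (Up x y)
    Up? x y = x ∈ˢ? nodes ×-dec ¬? (x ≟ root) ×-dec y ≟ parent x

    Up∈ : ∀ {x y} → Up x y → y ∈ˢ nodes
    Up∈ (x∈ , x≢r , refl) = parent∈ x∈ x≢r

    Up~ : ∀ {x y} → Up x y → x ~ y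
    Up~ (x∈ , x≢r , refl) = parent~ x∈ x≢r

    subgraph : Subgraph G
    subgraph = record
      { vertices = nodes
      ; Edge     = λ x y → Up x y ⊎ Up y x
      ; Edge?    = λ x y → Up? x y ⊎-dec Up? y x
      ; Edge-sym = swap
      ; Edge⇒~   = [ Up~ , ~-sym ∘ Up~ ]′
      ; Edge-end = [ proj₁ , Up∈ ]′
      }

    open Subgraph subgraph using (Edge)

    depth : Vertex → ℕ
    depth x with x ≟ root | parent x ≟ root
    ... | yes _ | _     = 0
    ... | no  _ | yes _ = 1
    ... | no  _ | no  _ = 2

    depth-root : depth root ≡ 0
    depth-root with root ≟ root | parent root ≟ root
    ... | yes _   | _ = refl
    ... | no  r≢r | _ = contradiction refl r≢r

    depth≤1 : ∀ {x} → parent x ≡ root → depth x ≤ 1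
    depth≤1 {x} px≡r with x ≟ root | parent x ≟ root
    ... | yes _ | _       = z≤n
    ... | no  _ | yes _   = s≤s z≤n
    ... | no  _ | no px≢r = contradiction px≡r px≢r

    depth-nonRoot : ∀ {x} → x ≢ root → (parent x ≡ root × depth x ≡ 1) ⊎ (parent x ≢ root × depth x ≡ 2)
    depth-nonRoot {x} x≢r with x ≟ root | parent x ≟ root
    ... | yes x≡r | _        = contradiction x≡r x≢r
    ... | no _    | yes px≡r = inj₁ (px≡r , refl)
    ... | no _    | no  px≢r = inj₂ (px≢r , refl)

    Up-depth : ∀ {x y} → Up x y → depth y < depth x
    Up-depth (x∈ , x≢r , refl) with depth-nonRoot x≢r
    ... | inj₁ (px≡r , d≡1) = ℕ.≤-reflexive (trans (cong suc (trans (cong depth px≡r) depth-root)) (sym d≡1))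
    ... | inj₂ (px≢r , d≡2) = ℕ.≤-trans (s≤s (depth≤1 (height≤2 x∈ x≢r px≢r))) (ℕ.≤-reflexive (sym d≡2))

    toRoot : ∀ {x} → x ∈ˢ nodes → Star Edge x root
    toRoot {x} x∈ with x ≟ root
    ... | yes refl = ε
    ... | no  x≢r with parent x ≟ root
    ... | yes px≡r = inj₁ (x∈ , x≢r , sym px≡r) ◅ ε
    ... | no  px≢r = inj₁ (x∈ , x≢r , refl) ◅
                     inj₁ (parent∈ x∈ x≢r , px≢r , sym (height≤2 x∈ x≢r px≢r)) ◅ ε

    isTree : IsTree subgraph
    isTree = (root , root∈) , (λ u∈ v∈ → toRoot u∈ ◅◅ reverse swap (toRoot v∈)) , acyclic
      where
      acyclic : Acyclic subgraph
      acyclic x []            (() , _)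
      acyclic x (p ∷ [])      (s≤s () , _)
      acyclic x (p ∷ q ∷ ys) (_ , u , walk) =
        noCycle depth (λ { (_ , _ , refl) (_ , _ , refl) → refl }) Up-depth x p q ys walk u

    -- An edge is determined by its lower end, a node other than the root, so colors may be compared
    -- through φ on these nodes. The four cases are the orientations of the two edges.
    isRainbow : ∀ {t} (c : EdgeColoring G t) (φ : Vertex → Fin t) →
      (∀ {x} → x ∈ˢ nodes → x ≢ root → (e : x ~ parent x) → EdgeColoring.color c e ≡ φ x) →
      (∀ {x y} → x ∈ˢ nodes → x ≢ root → y ∈ˢ nodes → y ≢ root → φ x ≡ φ y → x ≡ y) →
      IsRainbow c subgraph
    isRainbow c φ color≡φ φ-injective = rainbow
      where
      open EdgeColoring c
      color-Up : ∀ {x y} → Up x y → (e : x ~ y) → color e ≡ φ x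
      color-Up (x∈ , x≢r , refl) e = color≡φ x∈ x≢r e
      same : ∀ {x y z w} → Up x y → Up z w → φ x ≡ φ z → x ≡ z × y ≡ w
      same (x∈ , x≢r , refl) (z∈ , z≢r , refl) eq with φ-injective x∈ x≢r z∈ z≢r eq
      ... | refl = refl , refl
      rainbow : IsRainbow c subgraph
      rainbow (inj₁ p) (inj₁ q) eq = inj₁ (same p q (trans (sym (color-Up p _)) (trans eq (color-Up q _))))
      rainbow (inj₁ p) (inj₂ q) eq = inj₂ (same p q
        (trans (sym (color-Up p _)) (trans eq (trans (color-sym _ (Up~ q)) (color-Up q _)))))
      rainbow (inj₂ p) (inj₁ q) eq with same p q
        (trans (sym (color-Up p _)) (trans (color-sym (Up~ p) _) (trans eq (color-Up q _))))
      ... | eq₁ , eq₂ = inj₂ (eq₂ , eq₁)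
      rainbow (inj₂ p) (inj₂ q) eq with same p q
        (trans (sym (color-Up p _)) (trans (color-sym (Up~ p) _)
          (trans eq (trans (color-sym _ (Up~ q)) (color-Up q _)))))
      ... | eq₁ , eq₂ = inj₁ (eq₂ , eq₁)

  open ParentTree

  -- By the second hypothesis both ends of a common edge lie in S, so only edges inside S have to be
  -- separated. The two inequalities exclude the two orientations in the other tree.
  parentTrees-disjoint : ∀ {ℓ S} (T : Fin ℓ → ParentTree) → (∀ i → S ⊆ˢ nodes (T i)) →
    (∀ {i j x} → i ≢ j → x ∈ˢ nodes (T i) → x ∈ˢ nodes (T j) → x ∈ˢ S) →
    (∀ {i j x} → i ≢ j → x ∈ˢ S → parent (T i) x ∈ˢ S →
      parent (T i) x ≢ parent (T j) x × parent (T j) (parent (T i) x) ≢ x) →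
    InternallyDisjoint S (subgraph ∘ T)
  parentTrees-disjoint {S = S} T S⊆ meet separate i j i≢j = noCommonEdge , ⊆-antisym
    (λ x∈ → let x∈ᵢ , x∈ⱼ = x∈p∩q⁻ _ _ x∈ in meet i≢j x∈ᵢ x∈ⱼ) (λ x∈ → x∈p∩q⁺ (S⊆ i x∈ , S⊆ j x∈))
    where
    noUp : ∀ {u v} → Up (T i) u v → ¬ Subgraph.Edge (subgraph (T j)) u v
    noUp up@(u∈ , _ , refl) e = [ (λ (_ , _ , eq) → proj₁ sep eq) , (λ (_ , _ , eq) → proj₂ sep (sym eq)) ]′ e
      where
      sep = separate i≢j (meet i≢j u∈ (Subgraph.Edge-end (subgraph (T j)) e))
              (meet i≢j (Up∈ (T i) up) (Subgraph.Edge-end (subgraph (T j)) (swap e)))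
    noCommonEdge : ∀ u v → ¬ (Subgraph.Edge (subgraph (T i)) u v × Subgraph.Edge (subgraph (T j)) u v)
    noCommonEdge u v (inj₁ up , e) = noUp up e
    noCommonEdge u v (inj₂ up , e) = noUp up (swap e)

-- The edge-coloring of the complete bipartite graph.

enumerate : ∀ {n k} (S : Subset n) → ∣ S ∣ ≡ k → Σ[ p ∈ (Fin k → Fin n) ]
  (∀ i → p i ∈ˢ S) × Injective _≡_ _≡_ p × (∀ {x} → x ∈ˢ S → ∃[ i ] p i ≡ x)
enumerate Vec.[] refl = (λ ()) , (λ ()) , (λ { {()} }) , λ ()
enumerate (outside Vec.∷ S) refl with enumerate S refl
... | p , p∈ , inj , cover = suc ∘ p , Vec.there ∘ p∈ , inj ∘ suc-injective
    , λ { (Vec.there x∈) → map₂ (cong suc) (cover x∈) }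
enumerate {suc n} (inside Vec.∷ S) refl with enumerate S refl
... | p , p∈ , inj , cover = zero Vector.∷ suc ∘ p , (λ { zero → Vec.here ; (suc i) → Vec.there (p∈ i) })
    , p′-injective
    , λ { Vec.here → zero , refl ; (Vec.there x∈) → let i , eq = cover x∈ in suc i , cong suc eq }
  where
  p′-injective : Injective _≡_ _≡_ (zero Vector.∷ (suc ∘ p))
  p′-injective {zero}  {zero}  eq = refl
  p′-injective {suc i} {suc j} eq = cong suc (inj (suc-injective eq))

x∈S∪⁅y⁆⁻ : ∀ {n} {S : Subset n} {x y} → x ∈ˢ S ∪ ⁅ y ⁆ → x ∈ˢ S ⊎ x ≡ y
x∈S∪⁅y⁆⁻ {S = S} {y = y} x∈ = [ inj₁ , inj₂ ∘ x∈⁅y⁆⇒x≡y y ]′ (x∈p∪q⁻ S ⁅ y ⁆ x∈)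

module Coloring {n t k ℓ : ℕ} (E : ExtensionColoring n t k ℓ) where
  open Bipartite n public
  open Graph G public
  open ExtensionColoring E using (tagˡ; tagʳ; extensionˡ; extensionʳ) renaming (color to f)

  endSide : Fin n ⊎ Fin n → Bool
  endSide = [ const false , const true ]′

  -- The ends are passed already split, so that matching on them reveals their sides and a proof of
  -- `u ~ v` has the required type by unfolding.
  pick : ∀ x y → endSide x ≢ endSide y → Fin t
  pick (inj₁ a) (inj₂ b) _ = f a b
  pick (inj₂ b) (inj₁ a) _ = f a b
  pick (inj₁ _) (inj₁ _) p = contradiction refl p
  pick (inj₂ _) (inj₂ _) p = contradiction refl p

  pick-sym : ∀ x y p q → pick x y p ≡ pick y x q
  pick-sym (inj₁ a) (inj₂ b) _ _ = refl
  pick-sym (inj₂ b) (inj₁ a) _ _ = refl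
  pick-sym (inj₁ _) (inj₁ _) p _ = contradiction refl p
  pick-sym (inj₂ _) (inj₂ _) p _ = contradiction refl p

  coloring : EdgeColoring G t
  coloring = record
    { color     = λ {u} {v} → pick (splitAt n u) (splitAt n v)
    ; color-sym = λ {u} {v} → pick-sym (splitAt n u) (splitAt n v) }

  open EdgeColoring coloring public

  tag : Vertex → Fin ℓ
  tag = [ tagˡ , tagʳ ]′ ∘ splitAt n

  position : Vertex → Fin n
  position = [ id , id ]′ ∘ splitAt n

  Extends : ∀ {m} → Bool → Fin ℓ → (Fin m → Vertex) → (Fin m → Vertex) → (Vertex → Fin t) → Vertex → Set
  Extends s i X p g w = side n n w ≡ s × tag w ≡ i × (∀ j → X j ≢ w) ×
                        (∀ j → (e : w ~ p j) → color e ≡ g (p j))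

  -- Points on the side of w may occur in p: `position` forgets their side, and the condition on
  -- their colors is vacuous since they are not adjacent to w. So S need not be sorted by sides.
  extension : ∀ s i (X p : Fin k → Vertex) g → ∃[ w ] Extends s i X p g w
  extension false i X p g with extensionˡ i (position ∘ X) (position ∘ p) (g ∘ right)
  ... | a , tag≡ , a∉ , colors = left a , side-left a , trans (cong [ tagˡ , tagʳ ]′ (splitAt-↑ˡ n a n)) tag≡
      , (λ j eq → a∉ j (trans (cong position eq) (cong [ id , id ]′ (splitAt-↑ˡ n a n))))
      , realized
    where
    realized : ∀ j (e : left a ~ p j) → color e ≡ g (p j)
    realized j e with splitAt n (left a) | splitAt-↑ˡ n a n | splitAt n (p j) in eq | colors j
    ... | _ | refl | inj₁ b | _ = contradiction refl e
    ... | _ | refl | inj₂ b | f≡g = trans f≡g (cong g (splitAt⁻¹-↑ʳ eq))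
  extension true i X p g with extensionʳ i (position ∘ X) (position ∘ p) (g ∘ left)
  ... | b , tag≡ , b∉ , colors = right b , side-right b , trans (cong [ tagˡ , tagʳ ]′ (splitAt-↑ʳ n n b)) tag≡
      , (λ j eq → b∉ j (trans (cong position eq) (cong [ id , id ]′ (splitAt-↑ʳ n n b))))
      , realized
    where
    realized : ∀ j (e : right b ~ p j) → color e ≡ g (p j)
    realized j e with splitAt n (right b) | splitAt-↑ʳ n n b | splitAt n (p j) in eq | colors j
    ... | _ | refl | inj₂ a | _ = contradiction refl e
    ... | _ | refl | inj₁ a | f≡g = trans f≡g (cong g (splitAt⁻¹-↑ˡ eq))

-- Upper bound with k + 1 colors.

-- The trees are double stars: adjacent centres u and v outside S, every vertex of S joined to
-- the centre on the opposite side. The k + 1 edges get distinct colors.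
module DoubleStars {n k ℓ : ℕ} (E : ExtensionColoring n (2 + k) (2 + k) ℓ) where
  open Coloring E

  module _ (S : Subset (n + n)) (card : ∣ S ∣ ≡ suc k) where
    p = proj₁ (enumerate S card)
    p-injective = proj₁ (proj₂ (proj₂ (enumerate S card)))
    p-covers : ∀ {x} → x ∈ˢ S → ∃[ i ] p i ≡ x
    p-covers = proj₂ (proj₂ (proj₂ (enumerate S card)))

    -- The color intended for the edge from x to its parent: vertices of S use their index, and the
    -- last color is left for the edge between the two centres.
    φ : Vertex → Fin (2 + k)
    φ x with x ∈ˢ? S
    ... | yes x∈ = inject₁ (proj₁ (p-covers x∈))
    ... | no  _  = fromℕ (suc k)

    φ-injective : ∀ {v x y} → v ∉ˢ S → x ∈ˢ S ⊎ x ≡ v → y ∈ˢ S ⊎ y ≡ v → φ x ≡ φ y → x ≡ y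
    φ-injective {v} {x} {y} v∉ x∈ y∈ eq with x ∈ˢ? S | y ∈ˢ? S
    ... | yes x∈S | yes y∈S = trans (sym (proj₂ (p-covers x∈S)))
                                (trans (cong p (inject₁-injective eq)) (proj₂ (p-covers y∈S)))
    ... | yes x∈S | no  _   = contradiction (sym eq) fromℕ≢inject₁
    ... | no  _   | yes y∈S = contradiction eq fromℕ≢inject₁
    ... | no  x∉S | no  y∉S = trans (isV x∉S x∈) (sym (isV y∉S y∈))
      where
      isV : ∀ {z} → z ∉ˢ S → z ∈ˢ S ⊎ z ≡ v → z ≡ v
      isV z∉S = [ flip contradiction z∉S , id ]′

    points : Vertex → Fin (2 + k) → Vertex
    points x = x Vector.∷ p

    module _ (i : Fin ℓ) where
      -- The centre v has only S to respect, so the spare slot repeats `p zero`. The centre u,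
      -- chosen afterwards, has v in that slot and thus also realizes the color of uv.
      v-spec = extension true i (points (p zero)) (points (p zero)) φ
      v = proj₁ v-spec
      u-spec = extension false i (points v) (points v) φ
      u = proj₁ u-spec
      side-v = proj₁ (proj₂ v-spec)
      side-u = proj₁ (proj₂ u-spec)
      tag-v = proj₁ (proj₂ (proj₂ v-spec))
      tag-u = proj₁ (proj₂ (proj₂ u-spec))

      v∉S : v ∉ˢ S
      v∉S v∈ = let j , eq = p-covers v∈ in proj₁ (proj₂ (proj₂ (proj₂ v-spec))) (suc j) eq

      u∉S : u ∉ˢ S
      u∉S u∈ = let j , eq = p-covers u∈ in proj₁ (proj₂ (proj₂ (proj₂ u-spec))) (suc j) eq

      v-color : ∀ {x} → x ∈ˢ S → (e : v ~ x) → color e ≡ φ x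
      v-color x∈ e with p-covers x∈
      ... | j , refl = proj₂ (proj₂ (proj₂ (proj₂ v-spec))) (suc j) e

      u-color : ∀ {x} → x ∈ˢ S ⊎ x ≡ v → (e : u ~ x) → color e ≡ φ x
      u-color (inj₂ refl) e = proj₂ (proj₂ (proj₂ (proj₂ u-spec))) zero e
      u-color (inj₁ x∈) e with p-covers x∈
      ... | j , refl = proj₂ (proj₂ (proj₂ (proj₂ u-spec))) (suc j) e

      centre : Vertex → Vertex
      centre x = if side n n x then u else v

      centre-cases : ∀ x → (side n n x ≡ true × centre x ≡ u) ⊎ (side n n x ≡ false × centre x ≡ v)
      centre-cases x with side n n x
      ... | true  = inj₁ (refl , refl)
      ... | false = inj₂ (refl , refl)

      centre-v : centre v ≡ u
      centre-v rewrite side-v = refl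

      nodes⁻ : ∀ {x} → x ∈ˢ (S ∪ ⁅ v ⁆) ∪ ⁅ u ⁆ → (x ∈ˢ S ⊎ x ≡ v) ⊎ x ≡ u
      nodes⁻ x∈ = [ inj₁ ∘ x∈S∪⁅y⁆⁻ , inj₂ ]′ (x∈S∪⁅y⁆⁻ x∈)

      S⊆nodes : S ⊆ˢ (S ∪ ⁅ v ⁆) ∪ ⁅ u ⁆
      S⊆nodes x∈ = x∈p∪q⁺ (inj₁ (x∈p∪q⁺ (inj₁ x∈)))

      centre∈ : ∀ x → centre x ∈ˢ (S ∪ ⁅ v ⁆) ∪ ⁅ u ⁆
      centre∈ x with side n n x
      ... | true  = x∈p∪q⁺ (inj₂ (x∈⁅x⁆ u))
      ... | false = x∈p∪q⁺ (inj₁ (x∈p∪q⁺ (inj₂ (x∈⁅x⁆ v))))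

      centre∉S : ∀ x → centre x ∉ˢ S
      centre∉S x with side n n x
      ... | true  = u∉S
      ... | false = v∉S

      centre~ : ∀ x → x ~ centre x
      centre~ x eq with centre-cases x
      ... | inj₁ (x-true , c≡u) = not-¬ x-true (trans eq (trans (cong (side n n) c≡u) side-u))
      ... | inj₂ (x-false , c≡v) = not-¬ x-false (trans eq (trans (cong (side n n) c≡v) side-v))

      doubleStar : ParentTree G
      doubleStar = record
        { nodes = (S ∪ ⁅ v ⁆) ∪ ⁅ u ⁆ ; root = u ; parent = centre
        ; root∈ = x∈p∪q⁺ (inj₂ (x∈⁅x⁆ u))
        ; parent∈ = λ {x} _ _ → centre∈ x
        ; parent~ = λ {x} _ _ → centre~ x
        ; height≤2 = λ {x} _ _ c≢u → [ (λ (_ , c≡u) → contradiction c≡u c≢u)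
                                     , (λ (_ , c≡v) → trans (cong centre c≡v) centre-v) ]′ (centre-cases x) }

      nonRoot : ∀ {x} → x ∈ˢ (S ∪ ⁅ v ⁆) ∪ ⁅ u ⁆ → x ≢ u → x ∈ˢ S ⊎ x ≡ v
      nonRoot x∈ x≢u = [ id , flip contradiction x≢u ]′ (nodes⁻ x∈)

      centre-color : ∀ {x} → x ∈ˢ (S ∪ ⁅ v ⁆) ∪ ⁅ u ⁆ → x ≢ u → (e : x ~ centre x) → color e ≡ φ x
      centre-color {x} x∈ x≢u e with centre x | centre-cases x
      ... | _ | inj₁ (_ , refl) = trans (color-sym e (~-sym e)) (u-color (nonRoot x∈ x≢u) (~-sym e))
      ... | _ | inj₂ (x-false , refl) = trans (color-sym e (~-sym e)) (v-color x∈S (~-sym e))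
        where
        x∈S : x ∈ˢ S
        x∈S = [ id , (λ { refl → contradiction refl e }) ]′ (nonRoot x∈ x≢u)

      doubleStar-rainbow : IsRainbowSTree coloring S (ParentTree.subgraph doubleStar)
      doubleStar-rainbow = ParentTree.isTree doubleStar , S⊆nodes ,
        ParentTree.isRainbow doubleStar coloring φ centre-color
          (λ x∈ x≢u y∈ y≢u → φ-injective v∉S (nonRoot x∈ x≢u) (nonRoot y∈ y≢u))

    -- Both centres of the i-th tree carry the tag i.
    meet : ∀ {i j x} → i ≢ j → x ∈ˢ ParentTree.nodes (doubleStar i) →
           x ∈ˢ ParentTree.nodes (doubleStar j) → x ∈ˢ S
    meet {i} {j} i≢j x∈ᵢ x∈ⱼ with nodes⁻ i x∈ᵢ | nodes⁻ j x∈ⱼ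
    ... | inj₁ (inj₁ x∈S)  | _ = x∈S
    ... | inj₁ (inj₂ _)    | inj₁ (inj₁ x∈S) = x∈S
    ... | inj₂ _           | inj₁ (inj₁ x∈S) = x∈S
    ... | inj₁ (inj₂ x≡vᵢ) | inj₁ (inj₂ x≡vⱼ) =
      contradiction (trans (sym (tag-v i)) (trans (cong tag (trans (sym x≡vᵢ) x≡vⱼ)) (tag-v j))) i≢j
    ... | inj₁ (inj₂ x≡vᵢ) | inj₂ x≡uⱼ =
      contradiction (trans (cong tag (trans (sym x≡vᵢ) x≡uⱼ)) (tag-u j)) (i≢j ∘ trans (sym (tag-v i)))
    ... | inj₂ x≡uᵢ        | inj₁ (inj₂ x≡vⱼ) =
      contradiction (trans (cong tag (trans (sym x≡uᵢ) x≡vⱼ)) (tag-v j)) (i≢j ∘ trans (sym (tag-u i)))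
    ... | inj₂ x≡uᵢ        | inj₂ x≡uⱼ =
      contradiction (trans (sym (tag-u i)) (trans (cong tag (trans (sym x≡uᵢ) x≡uⱼ)) (tag-u j))) i≢j

  colorable : RainbowColorable (suc k) ℓ G (2 + k)
  colorable = coloring , λ S card →
    ParentTree.subgraph ∘ doubleStar S card , doubleStar-rainbow S card ,
    parentTrees-disjoint G (doubleStar S card) (S⊆nodes S card) (meet S card)
      -- All parents are centres, which lie outside S, so no tree has an edge inside S.
      (λ {i} {j} {x} _ _ c∈ → contradiction c∈ (centre∉S S card i x))

-- Upper bound with three colors for k = 3 and two trees.

-- Every vertex of S on the side of the centre wᵢ hangs from an anchor aᵢ in S,
-- every other vertex of S from wᵢ.
module AnchoredStars {n t k ℓ : ℕ} (E : ExtensionColoring n t k ℓ) where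
  open Coloring E

  module _ (S : Subset (n + n)) (s : Bool) (p : Fin k → Vertex)
    (p-covers : ∀ {x} → x ∈ˢ S → ∃[ i ] p i ≡ x) (ψ : Fin ℓ → Vertex → Fin t)
    (ψ-injective : ∀ i {x y} → x ∈ˢ S → y ∈ˢ S → ψ i x ≡ ψ i y → x ≡ y)
    (anchor : Fin ℓ → Vertex)
    (anchored : ∀ {x} → x ∈ˢ S → side n n x ≡ s → ∀ i →
      anchor i ∈ˢ S × side n n (anchor i) ≢ s × (∀ j → i ≢ j → anchor i ≢ anchor j) ×
      (∀ (e : x ~ anchor i) → color e ≡ ψ i x))
    where

    module _ (i : Fin ℓ) where
      w-spec = extension s i p p (ψ i)
      w = proj₁ w-spec
      side-w = proj₁ (proj₂ w-spec)
      tag-w = proj₁ (proj₂ (proj₂ w-spec))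

      w∉S : w ∉ˢ S
      w∉S w∈ = let j , eq = p-covers w∈ in proj₁ (proj₂ (proj₂ (proj₂ w-spec))) j eq

      w-color : ∀ {x} → x ∈ˢ S → (e : w ~ x) → color e ≡ ψ i x
      w-color x∈ e with p-covers x∈
      ... | j , refl = proj₂ (proj₂ (proj₂ (proj₂ w-spec))) j e

      parent : Vertex → Vertex
      parent x with side n n x Bool.≟ s
      ... | yes _ = anchor i
      ... | no  _ = w

      parent-cases : ∀ x → (side n n x ≡ s × parent x ≡ anchor i) ⊎ (side n n x ≢ s × parent x ≡ w)
      parent-cases x with side n n x Bool.≟ s
      ... | yes x≡s = inj₁ (x≡s , refl)
      ... | no  x≢s = inj₂ (x≢s , refl)

      parent-w : ∀ {x} → side n n x ≢ s → parent x ≡ w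
      parent-w {x} x≢s = [ (λ (x≡s , _) → contradiction x≡s x≢s) , proj₂ ]′ (parent-cases x)

      nonRoot : ∀ {x} → x ∈ˢ S ∪ ⁅ w ⁆ → x ≢ w → x ∈ˢ S
      nonRoot x∈ x≢w = [ id , flip contradiction x≢w ]′ (x∈S∪⁅y⁆⁻ x∈)

      w∈ : w ∈ˢ S ∪ ⁅ w ⁆
      w∈ = x∈p∪q⁺ (inj₂ (x∈⁅x⁆ w))

      S⊆nodes : S ⊆ˢ S ∪ ⁅ w ⁆
      S⊆nodes x∈ = x∈p∪q⁺ (inj₁ x∈)

      parent∈ : ∀ {x} → x ∈ˢ S → parent x ∈ˢ S ∪ ⁅ w ⁆
      parent∈ {x} x∈ with parent-cases x
      ... | inj₁ (x≡s , eq) = subst (_∈ˢ S ∪ ⁅ w ⁆) (sym eq) (S⊆nodes (proj₁ (anchored x∈ x≡s i)))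
      ... | inj₂ (_   , eq) = subst (_∈ˢ S ∪ ⁅ w ⁆) (sym eq) w∈

      parent~ : ∀ {x} → x ∈ˢ S → x ~ parent x
      parent~ {x} x∈ eq with parent-cases x
      ... | inj₁ (x≡s , p≡a) = proj₁ (proj₂ (anchored x∈ x≡s i)) (trans (sym (trans eq (cong (side n n) p≡a))) x≡s)
      ... | inj₂ (x≢s , p≡w) = x≢s (trans eq (trans (cong (side n n) p≡w) side-w))

      grandparent : ∀ {x} → x ∈ˢ S → parent x ≢ w → parent (parent x) ≡ w
      grandparent {x} x∈ p≢w with parent-cases x
      ... | inj₁ (x≡s , p≡a) = trans (cong parent p≡a) (parent-w (proj₁ (proj₂ (anchored x∈ x≡s i))))
      ... | inj₂ (_   , p≡w) = contradiction p≡w p≢w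

      parent-color : ∀ {x} → x ∈ˢ S → (e : x ~ parent x) → color e ≡ ψ i x
      parent-color {x} x∈ e with parent x | parent-cases x
      ... | _ | inj₁ (x≡s , refl) = proj₂ (proj₂ (proj₂ (anchored x∈ x≡s i))) e
      ... | _ | inj₂ (_   , refl) = trans (color-sym e (~-sym e)) (w-color x∈ (~-sym e))

      tree : ParentTree G
      tree = record
        { nodes = S ∪ ⁅ w ⁆ ; root = w ; parent = parent ; root∈ = w∈
        ; parent∈ = λ x∈ x≢w → parent∈ (nonRoot x∈ x≢w)
        ; parent~ = λ x∈ x≢w → parent~ (nonRoot x∈ x≢w)
        ; height≤2 = λ x∈ x≢w → grandparent (nonRoot x∈ x≢w) }

      tree-rainbow : IsRainbowSTree coloring S (ParentTree.subgraph tree)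
      tree-rainbow = ParentTree.isTree tree , S⊆nodes ,
        ParentTree.isRainbow tree coloring (ψ i) (λ x∈ x≢w → parent-color (nonRoot x∈ x≢w))
          (λ x∈ x≢w y∈ y≢w → ψ-injective i (nonRoot x∈ x≢w) (nonRoot y∈ y≢w))

    meet : ∀ {i j x} → i ≢ j → x ∈ˢ S ∪ ⁅ w i ⁆ → x ∈ˢ S ∪ ⁅ w j ⁆ → x ∈ˢ S
    meet {i} {j} i≢j x∈ᵢ x∈ⱼ with x∈S∪⁅y⁆⁻ x∈ᵢ | x∈S∪⁅y⁆⁻ x∈ⱼ
    ... | inj₁ x∈S  | _         = x∈S
    ... | inj₂ _    | inj₁ x∈S  = x∈S
    ... | inj₂ x≡wᵢ | inj₂ x≡wⱼ =
      contradiction (trans (sym (tag-w i)) (trans (cong tag (trans (sym x≡wᵢ) x≡wⱼ)) (tag-w j))) i≢j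

    -- An edge inside S joins a vertex on side s to an anchor. Different trees have different
    -- anchors, and the parent of an anchor is a centre, which is outside S.
    separate : ∀ {i j x} → i ≢ j → x ∈ˢ S → parent i x ∈ˢ S →
               parent i x ≢ parent j x × parent j (parent i x) ≢ x
    separate {i} {j} {x} i≢j x∈ p∈ with parent-cases i x | parent-cases j x
    ... | inj₂ (_ , p≡w)   | _ = contradiction (subst (_∈ˢ S) p≡w p∈) (w∉S i)
    ... | inj₁ (x≡s , _)   | inj₂ (x≢s , _) = contradiction x≡s x≢s
    ... | inj₁ (x≡s , pᵢ≡) | inj₁ (_ , pⱼ≡) =
        (λ eq → proj₁ (proj₂ (proj₂ (anchored x∈ x≡s i))) j i≢j (trans (sym pᵢ≡) (trans eq pⱼ≡)))
      , λ eq → w∉S j (subst (_∈ˢ S) (trans (sym eq)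
          (trans (cong (parent j) pᵢ≡) (parent-w j (proj₁ (proj₂ (anchored x∈ x≡s i)))))) x∈)

    rainbowTrees : ∃[ T ] (∀ i → IsRainbowSTree coloring S (T i)) × InternallyDisjoint S T
    rainbowTrees = ParentTree.subgraph ∘ tree , tree-rainbow ,
      parentTrees-disjoint G tree S⊆nodes meet separate

transpose-matchˡ : ∀ {n} (i j : Fin n) → transpose i j i ≡ j
transpose-matchˡ i j with i ≟ i
... | yes _  = refl
... | no i≢i = contradiction refl i≢i

transpose-injective : ∀ {n} (i j : Fin n) → Injective _≡_ _≡_ (transpose i j)
transpose-injective i j eq =
  trans (sym (transpose-inverse j i)) (trans (cong (transpose j i) eq) (transpose-inverse j i))

-- Three vertices lie on one side or are divided two to one. The first case records the side that is
-- missed, where the centre of the star goes; in the second, l is the lone vertex.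
data Split (σ : Fin 3 → Bool) : Set where
  oneSided : ∀ s → (∀ m → σ m ≢ s) → Split σ
  twoSided : ∀ i j l → i ≢ j → σ i ≢ σ l → σ j ≢ σ l →
             (∀ m → σ m ≡ σ l → m ≡ l) → Split σ

split : ∀ σ → Split σ
split σ with σ 0F Bool.≟ σ 1F | σ 0F Bool.≟ σ 2F
... | yes σ₀≡σ₁ | yes σ₀≡σ₂ = oneSided (not (σ 0F)) λ
  { 0F → not-¬ refl ; 1F → not-¬ (sym σ₀≡σ₁) ; 2F → not-¬ (sym σ₀≡σ₂) }
... | yes σ₀≡σ₁ | no σ₀≢σ₂ = twoSided 0F 1F 2F (λ ()) σ₀≢σ₂ (σ₀≢σ₂ ∘ trans σ₀≡σ₁) λ
  { 0F eq → contradiction eq σ₀≢σ₂ ; 1F eq → contradiction (trans σ₀≡σ₁ eq) σ₀≢σ₂ ; 2F _ → refl }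
... | no σ₀≢σ₁ | yes σ₀≡σ₂ = twoSided 0F 2F 1F (λ ()) σ₀≢σ₁ (σ₀≢σ₁ ∘ trans σ₀≡σ₂) λ
  { 0F eq → contradiction eq σ₀≢σ₁ ; 1F _ → refl ; 2F eq → contradiction (trans σ₀≡σ₂ eq) σ₀≢σ₁ }
... | no σ₀≢σ₁ | no σ₀≢σ₂ = twoSided 1F 2F 0F (λ ()) (σ₀≢σ₁ ∘ sym) (σ₀≢σ₂ ∘ sym) λ
  { 0F _ → refl ; 1F eq → contradiction (sym eq) σ₀≢σ₁ ; 2F eq → contradiction (sym eq) σ₀≢σ₂ }

module ThreeColors {n : ℕ} (E : ExtensionColoring n 3 3 2) where
  open Coloring E

  module _ (S : Subset (n + n)) (p : Fin 3 → Vertex) (p∈ : ∀ i → p i ∈ˢ S)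
           (p-injective : Injective _≡_ _≡_ p) (p-covers : ∀ {x} → x ∈ˢ S → ∃[ i ] p i ≡ x) where

    φ : Vertex → Fin 3
    φ x with x ∈ˢ? S
    ... | yes x∈ = proj₁ (p-covers x∈)
    ... | no  _  = zero

    p∘φ : ∀ {x} → x ∈ˢ S → p (φ x) ≡ x
    p∘φ {x} x∈ with x ∈ˢ? S
    ... | yes x∈′ = proj₂ (p-covers x∈′)
    ... | no  x∉  = contradiction x∈ x∉

    φ-injective : ∀ {x y} → x ∈ˢ S → y ∈ˢ S → φ x ≡ φ y → x ≡ y
    φ-injective x∈ y∈ eq = trans (sym (p∘φ x∈)) (trans (cong p eq) (p∘φ y∈))

    φ∘p : ∀ i → φ (p i) ≡ i
    φ∘p i = p-injective (p∘φ (p∈ i))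

    trees : Split (side n n ∘ p) → ∃[ T ] (∀ i → IsRainbowSTree coloring S (T i)) × InternallyDisjoint S T
    trees (oneSided s s-missed) = AnchoredStars.rainbowTrees E S s p p-covers (λ _ → φ) (λ _ → φ-injective)
      -- `p zero` is a default anchor: no vertex of S lies on side s, so the trees are stars.
      (λ _ → p zero) (λ x∈ x≡s → contradiction
        (trans (cong (side n n) (proj₂ (p-covers x∈))) x≡s) (s-missed _))
    trees (twoSided i j l i≢j i≢l j≢l l-alone) =
      -- The centres go on the side of the lone vertex `p l`, which hangs from `p i` in one tree and
      -- from `p j` in the other; both trees are paths.
      AnchoredStars.rainbowTrees E S (side n n (p l)) p p-covers ψ
        (λ m x∈ y∈ eq → φ-injective x∈ y∈ (transpose-injective l (fixed m) eq)) anchor anchored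
      where
      anchor : Fin 2 → Vertex
      anchor 0F = p i
      anchor 1F = p j

      anchor∈ : ∀ m → anchor m ∈ˢ S
      anchor∈ 0F = p∈ i
      anchor∈ 1F = p∈ j

      anchor-side : ∀ m → side n n (anchor m) ≢ side n n (p l)
      anchor-side 0F = i≢l
      anchor-side 1F = j≢l

      anchor-distinct : ∀ m m′ → m ≢ m′ → anchor m ≢ anchor m′
      anchor-distinct 0F 0F m≢m′ _  = m≢m′ refl
      anchor-distinct 0F 1F _    eq = i≢j (p-injective eq)
      anchor-distinct 1F 0F _    eq = i≢j (sym (p-injective eq))
      anchor-distinct 1F 1F m≢m′ _  = m≢m′ refl

      p-l~anchor : ∀ m → p l ~ anchor m
      p-l~anchor m = anchor-side m ∘ sym

      fixed : Fin 2 → Fin 3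
      fixed m = color {p l} {anchor m} (p-l~anchor m)

      -- The color of the edge at p l is given; the two other vertices of S get the other colors.
      ψ : Fin 2 → Vertex → Fin 3
      ψ m x = transpose l (fixed m) (φ x)

      alone : ∀ {x} → x ∈ˢ S → side n n x ≡ side n n (p l) → x ≡ p l
      alone x∈ eq = trans (sym (p∘φ x∈)) (cong p (l-alone _ (trans (cong (side n n) (p∘φ x∈)) eq)))

      anchor-color : ∀ m {x} → x ≡ p l → (e : x ~ anchor m) → color {x} {anchor m} e ≡ ψ m x
      anchor-color m refl e = trans (color-irrelevant coloring {p l} {anchor m} e (p-l~anchor m))
        (sym (trans (cong (transpose l (fixed m)) (φ∘p l)) (transpose-matchˡ l (fixed m))))

      anchored : ∀ {x} → x ∈ˢ S → side n n x ≡ side n n (p l) → ∀ m →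
        anchor m ∈ˢ S × side n n (anchor m) ≢ side n n (p l) × (∀ m′ → m ≢ m′ → anchor m ≢ anchor m′) ×
        (∀ (e : x ~ anchor m) → color {x} {anchor m} e ≡ ψ m x)
      anchored x∈ x≡s m = anchor∈ m , anchor-side m , anchor-distinct m , anchor-color m (alone x∈ x≡s)

  colorable : RainbowColorable 3 2 G 3
  colorable = coloring , λ S card →
    let p , p∈ , p-injective , p-covers = enumerate S card
    in trees S p p∈ p-injective p-covers (split (side n n ∘ p))

-- Combining the bounds.

RainbowColorable-≤ : ∀ {k ℓ ℓ′ G t} → ℓ ≤ ℓ′ → RainbowColorable k ℓ′ G t → RainbowColorable k ℓ G t
RainbowColorable-≤ ℓ≤ℓ′ (c , rainbow) = c , λ S card →
  let T , trees , disjoint = rainbow S card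
  in T ∘ shift , trees ∘ shift ,
     λ i j i≢j → disjoint (shift i) (shift j) (i≢j ∘ inject≤-injective ℓ≤ℓ′ ℓ≤ℓ′ i j)
  where
  shift = λ i → inject≤ i ℓ≤ℓ′

-- Here k = 3 + r. The first family of colorings has k + 1 colors and prescribes k + 1 vertices,
-- namely S and one centre; the second gives two trees in three colors when k = 3.
indexFromThresholds : ∀ r ℓ → 1 ≤ ℓ →
  (∃[ N ] (∀ n → N ≤ n → ExtensionColoring n (4 + r) (4 + r) ℓ)) →
  (∃[ N ] (∀ n → N ≤ n → ExtensionColoring n 3 3 2)) →
  ∃[ N ] 1 ≤ N × (∀ n → N ≤ n →
  (3 + r ≡ 3 → ℓ ≡ 1 ⊎ ℓ ≡ 2 → RainbowIndex (3 + r) ℓ (completeBipartite n n) 3) ×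
  (3 + r ≡ 3 → 3 ≤ ℓ → RainbowIndex (3 + r) ℓ (completeBipartite n n) 4) ×
  (4 ≤ 3 + r → RainbowIndex (3 + r) ℓ (completeBipartite n n) (3 + r + 1)))
indexFromThresholds r ℓ 1≤ℓ (N₁ , manyColors) (N₂ , threeColors) =
  suc (N₁ ℕ.⊔ N₂ ℕ.⊔ N₃) , s≤s z≤n , λ n N<n →
    let N≤n  = ℕ.<⇒≤ N<n
        N₁≤n = ℕ.≤-trans (ℕ.≤-trans (ℕ.m≤m⊔n N₁ N₂) (ℕ.m≤m⊔n _ N₃)) N≤n
        N₂≤n = ℕ.≤-trans (ℕ.≤-trans (ℕ.m≤n⊔m N₁ N₂) (ℕ.m≤m⊔n _ N₃)) N≤n
        N₃≤n = ℕ.≤-trans (ℕ.m≤n⊔m (N₁ ℕ.⊔ N₂) N₃) N≤n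
        many = DoubleStars.colorable (manyColors n N₁≤n)
    in (λ { refl ℓ≤2 → RainbowColorable-≤ (two ℓ≤2) (ThreeColors.colorable (threeColors n N₂≤n))
                     , λ _ → colorable⇒k≤ N₃≤n 1≤ℓ })
     , (λ { refl 3≤ℓ → many , λ _ → colorable⇒k< N₃≤n (inj₂ 3≤ℓ) 1≤ℓ })
     , λ { (s≤s (s≤s (s≤s 1≤r))) →
           subst (RainbowIndex (3 + r) ℓ (completeBipartite n n)) (ℕ.+-comm 1 (3 + r))
             (many , λ _ → colorable⇒k< N₃≤n (inj₁ 1≤r) 1≤ℓ) }
  where
  N₃ = lowerThreshold (3 + r) r
  two : ℓ ≡ 1 ⊎ ℓ ≡ 2 → ℓ ≤ 2
  two (inj₁ refl) = s≤s z≤n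
  two (inj₂ refl) = s≤s (s≤s z≤n)

theorem2p4 : ∀ (k ℓ : ℕ) → 1 ≤ k → 1 ≤ ℓ → 3 ≤ k →
    ∃[ N ] 1 ≤ N × (∀ n → N ≤ n →
    (k ≡ 3 → ℓ ≡ 1 ⊎ ℓ ≡ 2 → RainbowIndex k ℓ (completeBipartite n n) 3) ×
    (k ≡ 3 → 3 ≤ ℓ → RainbowIndex k ℓ (completeBipartite n n) 4) ×
    (4 ≤ k → RainbowIndex k ℓ (completeBipartite n n) (k + 1)))
theorem2p4 (suc (suc (suc r))) (suc ℓ) _ 1≤ℓ (s≤s (s≤s (s≤s _))) =
  -- The last two arguments of `extensionColorings` are one less than the numbers of colors and of
  -- tags.
  indexFromThresholds r (suc ℓ) 1≤ℓ (extensionColorings (4 + r) (3 + r) ℓ) (extensionColorings 3 2 1)
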